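{- Let $k \in \mathbb{N}$ be even and let $r \in \mathbb{N}$ with $k \le r \le n/8$. Then any $k$-uniform hypergraph $\mathcal{H}$ with $n$ vertices and $m \ge 128\, n \log n \cdot \left(\frac{n}{r}\right)^{k/2-1}$ hyperedges has an even cover of size at most $\lceil r \log_2 n \rceil + 1$.
   Context: A $k$-uniform hypergraph on vertex set $[n]$ is a set of distinct $k$-element subsets of $[n]$ (hyperedges). An even cover is a nonempty collection of hyperedges such that every vertex belongs to an even number of hyperedges in the collection; its size is the number of hyperedges in it. -}

module Defs where

open import Data.Nat using (ℕ; zero; suc; _+_; _*_; _≤_; _<_)
open import Data.Nat.Logarithm using (⌈log₂_⌉)
open import Data.Integer using (+_)
open import Data.Rational as ℚ using (ℚ; _/_)
open import Data.Fin using (Fin)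
open import Data.Fin.Subset using (Subset; _∈_; ∣_∣; _∩_)
open import Data.Vec using (Vec; lookup; tabulate)
open import Data.Product using (Σ; ∃; _×_)
open import Relation.Binary.PropositionalEquality using (_≡_)

Even : ℕ → Set
Even a = ∃ λ t → a ≡ t + t

record Hypergraph (n k m : ℕ) : Set where
  field
    edge     : Fin m → Subset n
    uniform  : ∀ i → ∣ edge i ∣ ≡ k
    distinct : ∀ i j → edge i ≡ edge j → i ≡ j
open Hypergraph public

degreeIn : ∀ {n k m} → Hypergraph n k m → Subset m → Fin n → ℕ
degreeIn H C v = ∣ C ∩ tabulate (λ i → lookup (edge H i) v) ∣

IsEvenCover : ∀ {n k m} → Hypergraph n k m → Subset m → Set
IsEvenCover {n} H C = (∃ λ i → i ∈ C) × (∀ (v : Fin n) → Even (degreeIn H C v))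

expTerm : ℚ → ℕ → ℚ
expTerm q zero = ℚ.1ℚ
expTerm q (suc i) = expTerm q i ℚ.* q ℚ.* ((+ 1) / suc i)

expPartial : ℚ → ℕ → ℚ
expPartial q zero = expTerm q zero
expPartial q (suc N) = expPartial q N ℚ.+ expTerm q (suc N)

-- LnAtMost x q  means  ln x ≤ q  (natural logarithm), i.e. x ≤ exp q,
-- phrased without reals: for every rational ε > 0 some partial sum of the
-- exponential series for exp q exceeds x - ε (exp q is the supremum of these
-- increasing partial sums).
LnAtMost : ℕ → ℚ → Set
LnAtMost x q = ∀ (ε : ℚ) → ℚ.0ℚ ℚ.< ε →
  ∃ λ N → (+ x / 1) ℚ.< expPartial q N ℚ.+ ε

-- The rational a / b (b ≠ 0 in all uses; b = 0 mapped to 0 for totality).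
ratio : ℕ → ℕ → ℚ
ratio a zero = ℚ.0ℚ
ratio a (suc b) = (+ a) / suc b

{-# OPTIONS --safe #-}

-- Join two r-sets whose symmetric difference is a hyperedge (the Kikuchi graph). On average
-- a vertex has more than 12 r ⌈log₂ n⌉ neighbours, so deleting low-degree vertices leaves a
-- nonempty subgraph W of minimum degree D = 6 r ⌈log₂ n⌉. Fix s in W and let ∂ A be the sum
-- mod 2 of the hyperedges in A. Let a_i (reached i) be the number of sets A of i hyperedges
-- with s ⊕ ∂ A in W. Double counting extensions by one hyperedge gives (D − i) a_i ≤ (i + 1) a_{i+1},
-- hence a_ℓ ≥ 5^ℓ as long as 6 ℓ ≤ D. For ℓ = ⌈⌈log₂ n^r⌉ / 2⌉ this exceeds the number of
-- r-sets, so ∂ A = ∂ B for distinct A, B of size ℓ, and A ⊕ B is an even cover.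

module Submission where

open import Defs
open import Data.Nat using (ℕ; _+_; _*_; _∸_; _^_; _≤_)
open import Data.Nat.Logarithm using (⌈log₂_⌉)
open import Data.Fin.Subset using (Subset; ∣_∣)
open import Data.Product using (∃; _×_)
open import Relation.Binary.PropositionalEquality using (_≡_)

open import Data.Bool as Bool using (Bool; true; false; not; _xor_)
open import Data.Bool.Properties using (not-involutive; not-distribˡ-xor; not-distribʳ-xor; xor-annihilates-not; xor-assoc; xor-comm; xor-identityʳ; xor-same)
open import Data.Fin using (Fin; zero; suc)
open import Data.Fin.Subset using (_∈_; _∩_; ⊥; ∁)
open import Data.Fin.Subset.Properties using (anySubset?; ∣p∣≤n; ∣⊥∣≡0; ∣∁p∣≡n∸∣p∣)
open import Data.Integer as ℤ using () renaming (+_ to pos)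
import Data.Integer.Properties as ℤ
open import Data.List as List using (List; []; _∷_; _++_; length)
open import Data.Nat using (zero; suc; z≤n; s≤s; z<s; s≤s⁻¹; _<_; _≟_; _<?_; _!; NonZero; >-nonZero; ⌊_/2⌋; ⌈_/2⌉)
open import Data.Nat.Induction using (<-rec)
open import Data.Nat.Logarithm using (⌈log₂⌉-mono-≤; ⌈log₂⌈n/2⌉⌉≡⌈log₂n⌉∸1; ⌈log₂2^n⌉≡n)
open import Data.Nat.Properties
open import Data.Nat.Tactic.RingSolver using (solve-∀)
open import Data.Product using (_,_)
open import Data.Rational as ℚ using (ℚ; _/_; 0ℚ; 1ℚ; toℚᵘ)
import Data.Rational.Properties as ℚ
open import Data.Rational.Solver using (module +-*-Solver)
import Data.Rational.Unnormalised as ℚᵘ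
import Data.Rational.Unnormalised.Properties as ℚᵘ
open import Data.Sum using (_⊎_; inj₁; inj₂)
open import Data.Vec using ([]; _∷_; lookup; tabulate; zipWith; _[_]≔_)
open import Data.Vec.Properties using (≡-dec; lookup∘tabulate; tabulate∘lookup; tabulate-cong; lookup-zipWith; lookup-replicate; lookup⇒[]=)
open import Function using (_∘_)
open import Relation.Nullary using (Dec; yes; no; contradiction; _×-dec_; ¬?)
open import Relation.Binary.PropositionalEquality using (_≢_; refl; sym; trans; cong; cong₂; subst; module ≡-Reasoning)

-- Finite sums

-- Counting sets of hyperedges rather than walks is what makes a collision useful: two walks between
-- the same vertices may use the same hyperedges and cancel to nothing, whereas distinct sets have a
-- nonempty symmetric difference. The price is a growth factor (D - i) / (i + 1) per step instead of
-- D. This factor has to exceed 4: the two colliding sets have total size 2 ℓ, roughly log₂ of n^r,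
-- so that n^r is about 4^ℓ. A degree of 6 ℓ yields the factor 5, and 4^ℓ < 5^ℓ supplies the strict
-- inequality of the pigeonhole principle. The average degree is m times the probability that a
-- random r-set contains exactly half of a fixed hyperedge, which is at least (r/n)^(k/2). What the
-- constant 128 leaves over absorbs the passage from natural to rounded binary logarithms, for which
-- the crude bound e^(x/4) ≤ 2^(x + 1) is enough. Families of sets are indicator functions with
-- values in ℕ, so that double counting becomes an exchange of finite sums.

∑ : {A : Set} → List A → (A → ℕ) → ℕ
∑ []       f = 0
∑ (x ∷ xs) f = f x + ∑ xs f

module _ {A : Set} where

  ∑-cong : ∀ xs {f g : A → ℕ} → (∀ x → f x ≡ g x) → ∑ xs f ≡ ∑ xs g
  ∑-cong []       f≗g = refl
  ∑-cong (x ∷ xs) f≗g = cong₂ _+_ (f≗g x) (∑-cong xs f≗g)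

  ∑-mono-≤ : ∀ xs {f g : A → ℕ} → (∀ x → f x ≤ g x) → ∑ xs f ≤ ∑ xs g
  ∑-mono-≤ []       f≤g = z≤n
  ∑-mono-≤ (x ∷ xs) f≤g = +-mono-≤ (f≤g x) (∑-mono-≤ xs f≤g)

  ∑-+ : ∀ xs (f g : A → ℕ) → ∑ xs (λ x → f x + g x) ≡ ∑ xs f + ∑ xs g
  ∑-+ []       f g = refl
  ∑-+ (x ∷ xs) f g = trans (cong (f x + g x +_) (∑-+ xs f g)) (interchange (f x) (g x) (∑ xs f) (∑ xs g))
    where
    interchange : ∀ a b c d → a + b + (c + d) ≡ a + c + (b + d)
    interchange = solve-∀

  ∑-*ˡ : ∀ xs k (f : A → ℕ) → ∑ xs (λ x → k * f x) ≡ k * ∑ xs f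
  ∑-*ˡ []       k f = sym (*-zeroʳ k)
  ∑-*ˡ (x ∷ xs) k f = trans (cong (k * f x +_) (∑-*ˡ xs k f)) (sym (*-distribˡ-+ k (f x) (∑ xs f)))

  ∑-const : ∀ (xs : List A) k → ∑ xs (λ _ → k) ≡ length xs * k
  ∑-const []       k = refl
  ∑-const (x ∷ xs) k = cong (k +_) (∑-const xs k)

  ∑-++ : ∀ xs ys (f : A → ℕ) → ∑ (xs ++ ys) f ≡ ∑ xs f + ∑ ys f
  ∑-++ []       ys f = refl
  ∑-++ (x ∷ xs) ys f = trans (cong (f x +_) (∑-++ xs ys f)) (sym (+-assoc (f x) _ _))

  ∑-map : ∀ {B : Set} (h : B → A) xs (f : A → ℕ) → ∑ (List.map h xs) f ≡ ∑ xs (f ∘ h)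
  ∑-map h []       f = refl
  ∑-map h (x ∷ xs) f = cong (f (h x) +_) (∑-map h xs f)

  ∑-zero : ∀ (xs : List A) → ∑ xs (λ _ → 0) ≡ 0
  ∑-zero xs = trans (∑-const xs 0) (*-zeroʳ (length xs))

  ∑-zero⊎pos : ∀ xs (f : A → ℕ) → ∑ xs f ≡ 0 ⊎ ∃ λ x → 0 < f x
  ∑-zero⊎pos []       f = inj₁ refl
  ∑-zero⊎pos (x ∷ xs) f with f x in eq
  ... | suc _ = inj₂ (x , subst (0 <_) (sym eq) z<s)
  ... | zero  = ∑-zero⊎pos xs f

∑-swap : ∀ {A B : Set} xs ys (f : A → B → ℕ) →
  ∑ xs (λ x → ∑ ys (f x)) ≡ ∑ ys (λ y → ∑ xs (λ x → f x y))
∑-swap []       ys f = sym (∑-zero ys)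
∑-swap (x ∷ xs) ys f = trans (cong (∑ ys (f x) +_) (∑-swap xs ys f)) (sym (∑-+ ys (f x) _))

fins : ∀ m → List (Fin m)
fins zero    = []
fins (suc m) = zero ∷ List.map suc (fins m)

subsets : ∀ n → List (Subset n)
subsets zero    = [] ∷ []
subsets (suc n) = List.map (false ∷_) (subsets n) ++ List.map (true ∷_) (subsets n)

∑-fins-1 : ∀ m → ∑ (fins m) (λ _ → 1) ≡ m
∑-fins-1 zero    = refl
∑-fins-1 (suc m) = cong suc (trans (∑-map suc (fins m) _) (∑-fins-1 m))

∑-fins-const : ∀ m k → ∑ (fins m) (λ _ → k) ≡ m * k
∑-fins-const m k = begin
  ∑ (fins m) (λ _ → k)       ≡⟨ ∑-cong (fins m) (λ _ → sym (*-identityʳ k)) ⟩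
  ∑ (fins m) (λ _ → k * 1)   ≡⟨ ∑-*ˡ (fins m) k _ ⟩
  k * ∑ (fins m) (λ _ → 1)   ≡⟨ cong (k *_) (∑-fins-1 m) ⟩
  k * m                      ≡⟨ *-comm k m ⟩
  m * k                      ∎
  where open ≡-Reasoning

∑-subsets-suc : ∀ n (f : Subset (suc n) → ℕ) →
  ∑ (subsets (suc n)) f ≡ ∑ (subsets n) (f ∘ (false ∷_)) + ∑ (subsets n) (f ∘ (true ∷_))
∑-subsets-suc n f = trans (∑-++ (List.map (false ∷_) (subsets n)) _ f)
  (cong₂ _+_ (∑-map (false ∷_) (subsets n) f) (∑-map (true ∷_) (subsets n) f))

≤-∑-subsets : ∀ {n} (f : Subset n → ℕ) x → f x ≤ ∑ (subsets n) f
≤-∑-subsets f []          = m≤m+n (f []) 0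
≤-∑-subsets {suc n} f (false ∷ x) = ≤-trans (≤-∑-subsets (f ∘ (false ∷_)) x)
  (≤-trans (m≤m+n _ _) (≤-reflexive (sym (∑-subsets-suc n f))))
≤-∑-subsets {suc n} f (true ∷ x)  = ≤-trans (≤-∑-subsets (f ∘ (true ∷_)) x)
  (≤-trans (m≤n+m _ _) (≤-reflexive (sym (∑-subsets-suc n f))))

-- Indicator functions

𝟙 : Bool → ℕ
𝟙 false = 0
𝟙 true  = 1

δ : ∀ {n} → Subset n → Subset n → ℕ
δ []      []      = 1
δ (false ∷ x) (false ∷ y) = δ x y
δ (true  ∷ x) (true  ∷ y) = δ x y
δ (_     ∷ x) (_     ∷ y) = 0

δ-refl : ∀ {n} (x : Subset n) → δ x x ≡ 1
δ-refl []          = refl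
δ-refl (false ∷ x) = δ-refl x
δ-refl (true ∷ x)  = δ-refl x

δ-≡ : ∀ {n} (x y : Subset n) → 0 < δ x y → x ≡ y
δ-≡ []          []          _ = refl
δ-≡ (false ∷ x) (false ∷ y) p = cong (false ∷_) (δ-≡ x y p)
δ-≡ (true ∷ x)  (true ∷ y)  p = cong (true ∷_) (δ-≡ x y p)

δ≤1 : ∀ {n} (x y : Subset n) → δ x y ≤ 1
δ≤1 []          []          = ≤-refl
δ≤1 (false ∷ x) (false ∷ y) = δ≤1 x y
δ≤1 (true ∷ x)  (true ∷ y)  = δ≤1 x y
δ≤1 (false ∷ x) (true ∷ y)  = z≤n
δ≤1 (true ∷ x)  (false ∷ y) = z≤n

-- Makes the truncated subtraction `V y ∸ δ x y` in `prune` exact.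
δ≤ : ∀ {n} {f : Subset n → ℕ} {x} → 0 < f x → ∀ y → δ x y ≤ f y
δ≤ {x = x} 0<fx y with δ x y in eq
... | zero  = z≤n
... | suc k with refl ← δ-≡ x y (subst (0 <_) (sym eq) z<s) =
  ≤-trans (subst (_≤ 1) eq (δ≤1 x y)) 0<fx

∑-δ : ∀ {n} (x : Subset n) (f : Subset n → ℕ) → ∑ (subsets n) (λ y → δ x y * f y) ≡ f x
∑-δ []          f = trans (+-identityʳ _) (+-identityʳ _)
∑-δ {suc n} (false ∷ x) f = trans (∑-subsets-suc n _)
  (trans (cong₂ _+_ (∑-δ x (f ∘ (false ∷_))) (∑-zero (subsets n))) (+-identityʳ _))
∑-δ {suc n} (true ∷ x) f = trans (∑-subsets-suc n _)
  (cong₂ _+_ (∑-zero (subsets n)) (∑-δ x (f ∘ (true ∷_))))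

-- A positive value at x confines `f` to x, so `f` lies below `δ x` pointwise. This is the form in
-- which injectivity of `∂` enters the counting.
∑-subsingleton : ∀ {n} (f : Subset n → ℕ) → (∀ x → f x ≤ 1) →
  (∀ x y → 0 < f x → 0 < f y → x ≡ y) → ∑ (subsets n) f ≤ 1
∑-subsingleton {n} f f≤1 unique with ∑-zero⊎pos (subsets n) f
... | inj₁ eq        = subst (_≤ 1) (sym eq) z≤n
... | inj₂ (x , 0<fx) = begin
  ∑ (subsets n) f                    ≤⟨ ∑-mono-≤ (subsets n) f≤δ ⟩
  ∑ (subsets n) (λ y → δ x y * 1)    ≡⟨ ∑-δ x (λ _ → 1) ⟩
  1                                  ∎
  where
  open ≤-Reasoning
  f≤δ : ∀ y → f y ≤ δ x y * 1
  f≤δ y with f y in eq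
  ... | zero  = z≤n
  ... | suc k with refl ← unique x y 0<fx (subst (0 <_) (sym eq) z<s) =
    subst (suc k ≤_) (sym (cong (_* 1) (δ-refl x))) (subst (_≤ 1) eq (f≤1 y))

-- Symmetric difference

infixl 6 _⊕_
_⊕_ : ∀ {n} → Subset n → Subset n → Subset n
_⊕_ = zipWith _xor_

⊕-assoc : ∀ {n} (x y z : Subset n) → x ⊕ y ⊕ z ≡ x ⊕ (y ⊕ z)
⊕-assoc []      []      []      = refl
⊕-assoc (a ∷ x) (b ∷ y) (c ∷ z) = cong₂ _∷_ (xor-assoc a b c) (⊕-assoc x y z)

⊕-identityʳ : ∀ {n} (x : Subset n) → x ⊕ ⊥ ≡ x
⊕-identityʳ []      = refl
⊕-identityʳ (a ∷ x) = cong₂ _∷_ (xor-identityʳ a) (⊕-identityʳ x)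

⊕-self : ∀ {n} (x : Subset n) → x ⊕ x ≡ ⊥
⊕-self []      = refl
⊕-self (a ∷ x) = cong₂ _∷_ (xor-same a) (⊕-self x)

⊕-involutive : ∀ {n} (x y : Subset n) → x ⊕ y ⊕ y ≡ x
⊕-involutive x y = trans (⊕-assoc x y y) (trans (cong (x ⊕_) (⊕-self y)) (⊕-identityʳ x))

⊕-comm : ∀ {n} (x y : Subset n) → x ⊕ y ≡ y ⊕ x
⊕-comm []      []      = refl
⊕-comm (a ∷ x) (b ∷ y) = cong₂ _∷_ (xor-comm a b) (⊕-comm x y)

⊕-cancelˡ : ∀ {n} (s x y : Subset n) → s ⊕ x ≡ s ⊕ y → x ≡ y
⊕-cancelˡ s x y eq = begin
  x          ≡⟨ ⊕-involutive x s ⟨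
  x ⊕ s ⊕ s  ≡⟨ cong (_⊕ s) (trans (⊕-comm x s) (trans eq (⊕-comm s y))) ⟩
  y ⊕ s ⊕ s  ≡⟨ ⊕-involutive y s ⟩
  y          ∎
  where open ≡-Reasoning

-- Translation by c is an involution: coordinate by coordinate it swaps the two halves of `subsets`
-- exactly where c is true.
∑-translate : ∀ {n} (c : Subset n) (f : Subset n → ℕ) →
  ∑ (subsets n) (λ x → f (x ⊕ c)) ≡ ∑ (subsets n) f
∑-translate []          f = refl
∑-translate {suc n} (false ∷ c) f = trans (∑-subsets-suc n _)
  (trans (cong₂ _+_ (∑-translate c (f ∘ (false ∷_))) (∑-translate c (f ∘ (true ∷_))))
         (sym (∑-subsets-suc n f)))
∑-translate {suc n} (true ∷ c) f = trans (∑-subsets-suc n _)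
  (trans (cong₂ _+_ (∑-translate c (f ∘ (true ∷_))) (∑-translate c (f ∘ (false ∷_))))
         (trans (+-comm (∑ (subsets n) (f ∘ (true ∷_))) _) (sym (∑-subsets-suc n f))))

⊕-distinct : ∀ {n} {x y : Subset n} → x ≢ y → ∃ λ i → lookup (x ⊕ y) i ≡ true
⊕-distinct {x = []}        {[]}        x≢y = contradiction refl x≢y
⊕-distinct {x = false ∷ x} {true ∷ y}  x≢y = zero , refl
⊕-distinct {x = true ∷ x}  {false ∷ y} x≢y = zero , refl
⊕-distinct {x = false ∷ x} {false ∷ y} x≢y with i , p ← ⊕-distinct {x = x} {y} (x≢y ∘ cong (false ∷_)) = suc i , p
⊕-distinct {x = true ∷ x}  {true ∷ y}  x≢y with i , p ← ⊕-distinct {x = x} {y} (x≢y ∘ cong (true ∷_)) = suc i , p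

∣⊕∣≤ : ∀ {n} (x y : Subset n) → ∣ x ⊕ y ∣ ≤ ∣ x ∣ + ∣ y ∣
∣⊕∣≤ []          []          = z≤n
∣⊕∣≤ (false ∷ x) (false ∷ y) = ∣⊕∣≤ x y
∣⊕∣≤ (false ∷ x) (true ∷ y)  = ≤-trans (s≤s (∣⊕∣≤ x y)) (≤-reflexive (sym (+-suc ∣ x ∣ ∣ y ∣)))
∣⊕∣≤ (true ∷ x)  (false ∷ y) = s≤s (∣⊕∣≤ x y)
∣⊕∣≤ (true ∷ x)  (true ∷ y)  = m≤n⇒m≤1+n (≤-trans (∣⊕∣≤ x y) (+-monoʳ-≤ ∣ x ∣ (n≤1+n ∣ y ∣)))

-- Boundaries of sets of hyperedges

odd : ℕ → Bool
odd zero    = false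
odd (suc a) = not (odd a)

odd-∩-insert : ∀ {m} (A X : Subset m) c → lookup A c ≡ false →
  odd ∣ (A [ c ]≔ true) ∩ X ∣ ≡ odd ∣ A ∩ X ∣ xor lookup X c
odd-∩-insert (false ∷ A) (false ∷ X) zero    _ = sym (xor-identityʳ _)
odd-∩-insert (false ∷ A) (true ∷ X)  zero    _ with odd ∣ A ∩ X ∣
... | false = refl
... | true  = refl
odd-∩-insert (false ∷ A) (x ∷ X)     (suc c) p = odd-∩-insert A X c p
odd-∩-insert (true ∷ A)  (false ∷ X) (suc c) p = odd-∩-insert A X c p
odd-∩-insert (true ∷ A)  (true ∷ X)  (suc c) p =
  trans (cong not (odd-∩-insert A X c p)) (not-distribˡ-xor (odd ∣ A ∩ X ∣) (lookup X c))

odd-∩-⊕ : ∀ {m} (A B X : Subset m) → odd ∣ (A ⊕ B) ∩ X ∣ ≡ odd ∣ A ∩ X ∣ xor odd ∣ B ∩ X ∣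
odd-∩-⊕ []          []          []          = refl
odd-∩-⊕ (false ∷ A) (false ∷ B) (x ∷ X)     = odd-∩-⊕ A B X
odd-∩-⊕ (false ∷ A) (true ∷ B)  (false ∷ X) = odd-∩-⊕ A B X
odd-∩-⊕ (true ∷ A)  (false ∷ B) (false ∷ X) = odd-∩-⊕ A B X
odd-∩-⊕ (true ∷ A)  (true ∷ B)  (false ∷ X) = odd-∩-⊕ A B X
odd-∩-⊕ (false ∷ A) (true ∷ B)  (true ∷ X)  =
  trans (cong not (odd-∩-⊕ A B X)) (not-distribʳ-xor (odd ∣ A ∩ X ∣) (odd ∣ B ∩ X ∣))
odd-∩-⊕ (true ∷ A)  (false ∷ B) (true ∷ X)  =
  trans (cong not (odd-∩-⊕ A B X)) (not-distribˡ-xor (odd ∣ A ∩ X ∣) (odd ∣ B ∩ X ∣))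
odd-∩-⊕ (true ∷ A)  (true ∷ B)  (true ∷ X)  =
  trans (odd-∩-⊕ A B X) (sym (xor-annihilates-not (odd ∣ A ∩ X ∣) (odd ∣ B ∩ X ∣)))

∣⊥∩∣≡0 : ∀ {m} (X : Subset m) → ∣ ⊥ ∩ X ∣ ≡ 0
∣⊥∩∣≡0 []      = refl
∣⊥∩∣≡0 (x ∷ X) = ∣⊥∩∣≡0 X

∣insert∣ : ∀ {m} (A : Subset m) c → lookup A c ≡ false → ∣ A [ c ]≔ true ∣ ≡ suc ∣ A ∣
∣insert∣ (false ∷ A) zero    _ = refl
∣insert∣ (false ∷ A) (suc c) p = ∣insert∣ A c p
∣insert∣ (true ∷ A)  (suc c) p = cong suc (∣insert∣ A c p)

∑-𝟙-lookup : ∀ {m} (A : Subset m) → ∑ (fins m) (λ c → 𝟙 (lookup A c)) ≡ ∣ A ∣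
∑-𝟙-lookup {m = zero}  []          = refl
∑-𝟙-lookup {m = suc m} (false ∷ A) = trans (∑-map suc (fins m) _) (∑-𝟙-lookup A)
∑-𝟙-lookup {m = suc m} (true ∷ A)  = cong suc (trans (∑-map suc (fins m) _) (∑-𝟙-lookup A))

-- Insertion of c is a bijection from the sets that avoid c onto the sets that contain it.
∑-insert : ∀ {m} c (f : Subset m → ℕ) →
  ∑ (subsets m) (λ A → 𝟙 (not (lookup A c)) * f (A [ c ]≔ true)) ≡
  ∑ (subsets m) (λ A → 𝟙 (lookup A c) * f A)
∑-insert {suc m} zero f = trans (∑-subsets-suc m _)
  (trans (+-comm (∑ (subsets m) (λ A → 1 * f (true ∷ A))) _) (sym (∑-subsets-suc m _)))
∑-insert {suc m} (suc c) f = trans (∑-subsets-suc m _)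
  (trans (cong₂ _+_ (∑-insert c (f ∘ (false ∷_))) (∑-insert c (f ∘ (true ∷_))))
         (sym (∑-subsets-suc m _)))

-- The Kronecker delta on ℕ.
κ : ℕ → ℕ → ℕ
κ zero    zero    = 1
κ zero    (suc b) = 0
κ (suc a) zero    = 0
κ (suc a) (suc b) = κ a b

κ≤1 : ∀ a b → κ a b ≤ 1
κ≤1 zero    zero    = ≤-refl
κ≤1 zero    (suc b) = z≤n
κ≤1 (suc a) zero    = z≤n
κ≤1 (suc a) (suc b) = κ≤1 a b

κ-≡ : ∀ a b → 0 < κ a b → a ≡ b
κ-≡ zero    zero    _ = refl
κ-≡ (suc a) (suc b) p = cong suc (κ-≡ a b p)

κ-subst : ∀ a b → κ a b * a ≡ b * κ a b
κ-subst zero    zero    = refl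
κ-subst zero    (suc b) = sym (*-zeroʳ b)
κ-subst (suc a) zero    = refl
κ-subst (suc a) (suc b) = trans (*-suc (κ a b) a) (cong (κ a b +_) (κ-subst a b))

sized : ∀ {m} → ℕ → Subset m → ℕ
sized i A = κ ∣ A ∣ i

-- Behind the indicator one may assume `a ≡ b`. In `reached-suc` this replaces i by ∣ A ∣ in a bound
-- that holds set by set.
κ-mono : ∀ a b {p q} → (a ≡ b → p ≤ q) → κ a b * p ≤ κ a b * q
κ-mono a b p≤q with κ a b in eq
... | zero  = z≤n
... | suc k = *-monoʳ-≤ (suc k) (p≤q (κ-≡ a b (subst (0 <_) (sym eq) z<s)))

0<m*n⇒0<m : ∀ m {n} → 0 < m * n → 0 < m
0<m*n⇒0<m (suc m) _ = z<s

0<m*n⇒0<n : ∀ m {n} → 0 < m * n → 0 < n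
0<m*n⇒0<n m {zero}  p = subst (0 <_) (*-zeroʳ m) p
0<m*n⇒0<n m {suc n} p = z<s

module _ {n m : ℕ} (e : Fin m → Subset n) where

  -- The expression under `odd` is that of `degreeIn`, so a statement about `∂` is literally one
  -- about degrees in a collection of hyperedges.
  ∂ : Subset m → Subset n
  ∂ A = tabulate (λ v → odd ∣ A ∩ tabulate (λ i → lookup (e i) v) ∣)

  ⊕-tabulate : ∀ (f g : Fin n → Bool) → tabulate f ⊕ tabulate g ≡ tabulate (λ v → f v xor g v)
  ⊕-tabulate f g = trans (sym (tabulate∘lookup _)) (tabulate-cong λ v →
    trans (lookup-zipWith _xor_ v (tabulate f) (tabulate g)) (cong₂ _xor_ (lookup∘tabulate f v) (lookup∘tabulate g v)))

  ∂-insert : ∀ A c → lookup A c ≡ false → ∂ (A [ c ]≔ true) ≡ ∂ A ⊕ e c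
  ∂-insert A c p = begin
    ∂ (A [ c ]≔ true)
      ≡⟨ tabulate-cong (λ v → trans (odd-∩-insert A _ c p)
           (cong (odd ∣ A ∩ tabulate (λ i → lookup (e i) v) ∣ xor_) (lookup∘tabulate (λ i → lookup (e i) v) c))) ⟩
    tabulate (λ v → odd ∣ A ∩ tabulate (λ i → lookup (e i) v) ∣ xor lookup (e c) v)
      ≡⟨ ⊕-tabulate _ (lookup (e c)) ⟨
    ∂ A ⊕ tabulate (lookup (e c))
      ≡⟨ cong (∂ A ⊕_) (tabulate∘lookup (e c)) ⟩
    ∂ A ⊕ e c ∎
    where open ≡-Reasoning

  ∂-⊕ : ∀ A B → ∂ (A ⊕ B) ≡ ∂ A ⊕ ∂ B
  ∂-⊕ A B = trans (tabulate-cong λ v → odd-∩-⊕ A B _) (sym (⊕-tabulate _ _))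

  ∂-⊥ : ∂ ⊥ ≡ ⊥
  ∂-⊥ = trans (tabulate-cong λ v → trans (cong odd (∣⊥∩∣≡0 {m} _)) (sym (lookup-replicate v false)))
              (tabulate∘lookup ⊥)

  -- Degrees and pruning in the Kikuchi graph

  -- A set of vertices of the Kikuchi graph is encoded by its indicator function V; the
  -- degree sum energy V counts each edge twice.
  degree : (Subset n → ℕ) → Subset n → ℕ
  degree V x = ∑ (fins m) (λ c → V (x ⊕ e c))

  energy : (Subset n → ℕ) → ℕ
  energy V = ∑ (subsets n) (λ x → V x * degree V x)

  -- Adjacency is symmetric, since y ⊕ e c = x exactly when x ⊕ e c = y: the edges from `V` into x
  -- are as many as those from x into `V`.
  ∑-degree-δ : ∀ V x → ∑ (subsets n) (λ y → V y * degree (δ x) y) ≡ degree V x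
  ∑-degree-δ V x = begin
    ∑ (subsets n) (λ y → V y * ∑ (fins m) (λ c → δ x (y ⊕ e c)))
      ≡⟨ ∑-cong (subsets n) (λ y → ∑-*ˡ (fins m) (V y) _) ⟨
    ∑ (subsets n) (λ y → ∑ (fins m) (λ c → V y * δ x (y ⊕ e c)))
      ≡⟨ ∑-swap (subsets n) (fins m) _ ⟩
    ∑ (fins m) (λ c → ∑ (subsets n) (λ y → V y * δ x (y ⊕ e c)))
      ≡⟨ ∑-cong (fins m) (λ c → ∑-cong (subsets n) (λ y →
           trans (*-comm (V y) _) (cong (λ z → δ x (y ⊕ e c) * V z) (sym (⊕-involutive y (e c)))))) ⟩
    ∑ (fins m) (λ c → ∑ (subsets n) (λ y → δ x (y ⊕ e c) * V (y ⊕ e c ⊕ e c)))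
      ≡⟨ ∑-cong (fins m) (λ c → ∑-translate (e c) (λ z → δ x z * V (z ⊕ e c))) ⟩
    ∑ (fins m) (λ c → ∑ (subsets n) (λ z → δ x z * V (z ⊕ e c)))
      ≡⟨ ∑-cong (fins m) (λ c → ∑-δ x (λ z → V (z ⊕ e c))) ⟩
    degree V x ∎
    where open ≡-Reasoning

  -- The loss consists of the edges leaving x and the edges entering x; by symmetry each kind is at
  -- most a degree of x.
  energy-remove : ∀ V V′ x → (∀ y → V y ≡ V′ y + δ x y) →
    energy V ≤ energy V′ + 2 * degree V x
  energy-remove V V′ x V≡ = begin
    energy V
      ≡⟨ ∑-cong (subsets n) split ⟩
    ∑ (subsets n) (λ y → V′ y * degree V′ y + V′ y * degree (δ x) y + δ x y * degree V y)
      ≡⟨ ∑-+ (subsets n) _ _ ⟩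
    ∑ (subsets n) (λ y → V′ y * degree V′ y + V′ y * degree (δ x) y) + ∑ (subsets n) (λ y → δ x y * degree V y)
      ≡⟨ cong₂ _+_ (∑-+ (subsets n) _ _) (∑-δ x (degree V)) ⟩
    energy V′ + ∑ (subsets n) (λ y → V′ y * degree (δ x) y) + degree V x
      ≡⟨ cong (λ t → energy V′ + t + degree V x) (∑-degree-δ V′ x) ⟩
    energy V′ + degree V′ x + degree V x
      ≤⟨ +-monoˡ-≤ (degree V x) (+-monoʳ-≤ (energy V′)
           (∑-mono-≤ (fins m) (λ c → ≤-trans (m≤m+n _ _) (≤-reflexive (sym (V≡ (x ⊕ e c))))))) ⟩
    energy V′ + degree V x + degree V x
      ≡⟨ double (energy V′) (degree V x) ⟩
    energy V′ + 2 * degree V x ∎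
    where
    open ≤-Reasoning
    double : ∀ a b → a + b + b ≡ a + 2 * b
    double = solve-∀
    expand : ∀ a b c d → (a + b) * (c + d) ≡ a * c + a * d + b * (c + d)
    expand = solve-∀
    degree-V≡ : ∀ y → degree V y ≡ degree V′ y + degree (δ x) y
    degree-V≡ y = trans (∑-cong (fins m) (λ c → V≡ (y ⊕ e c))) (∑-+ (fins m) _ _)
    split : ∀ y → V y * degree V y ≡ V′ y * degree V′ y + V′ y * degree (δ x) y + δ x y * degree V y
    split y rewrite degree-V≡ y | V≡ y = expand (V′ y) (δ x y) (degree V′ y) (degree (δ x) y)

  Pruned : ℕ → (Subset n → ℕ) → (Subset n → ℕ) → Set
  Pruned D V W = (∀ x → W x ≤ V x) × (∃ λ x → 0 < W x) × (∀ x → 0 < W x → D ≤ degree W x)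

  -- The last hypothesis says that the average degree exceeds 2 D. It survives the removal of a
  -- vertex of degree below D, because its left side falls by 2 D and its right side by no more.
  -- Each removal lowers the volume by one, so `fuel` bounds their number.
  prune : ∀ fuel D V → ∑ (subsets n) V ≤ fuel → 2 * D * ∑ (subsets n) V < energy V → ∃ (Pruned D V)
  prune fuel D V vol≤ dense with anySubset? (λ x → 0 <? V x ×-dec degree V x <? D)
  -- The strict inequality forces a positive degree sum, so the graph is nonempty when the process
  -- stops.
  ... | no none with ∑-zero⊎pos (subsets n) (λ x → V x * degree V x)
  ...   | inj₁ energy≡0 = contradiction (subst (_ <_) energy≡0 dense) λ ()
  ...   | inj₂ (x , 0<) = V , (λ _ → ≤-refl) , (x , 0<m*n⇒0<m (V x) 0<) ,
                          λ y 0<Vy → ≮⇒≥ (λ d<D → none (y , 0<Vy , d<D))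
  prune fuel D V vol≤ dense | yes (x , 0<Vx , d<D) = descend fuel vol≤
    where
    V′ : Subset n → ℕ
    V′ y = V y ∸ δ x y
    V≡ : ∀ y → V y ≡ V′ y + δ x y
    V≡ y = sym (m∸n+n≡m (δ≤ {f = V} 0<Vx y))
    vol≡ : ∑ (subsets n) V ≡ suc (∑ (subsets n) V′)
    vol≡ = begin
      ∑ (subsets n) V                                  ≡⟨ ∑-cong (subsets n) V≡ ⟩
      ∑ (subsets n) (λ y → V′ y + δ x y)               ≡⟨ ∑-+ (subsets n) V′ (δ x) ⟩
      ∑ (subsets n) V′ + ∑ (subsets n) (δ x)           ≡⟨ cong (∑ (subsets n) V′ +_) (trans (∑-cong (subsets n) (λ y → sym (*-identityʳ (δ x y)))) (∑-δ x (λ _ → 1))) ⟩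
      ∑ (subsets n) V′ + 1                             ≡⟨ +-comm _ 1 ⟩
      suc (∑ (subsets n) V′)                           ∎
      where open ≡-Reasoning
    dense′ : 2 * D * ∑ (subsets n) V′ < energy V′
    dense′ = +-cancelʳ-< (2 * D) _ _ (begin-strict
      2 * D * ∑ (subsets n) V′ + 2 * D     ≡⟨ trans (+-comm _ (2 * D)) (sym (*-suc (2 * D) _)) ⟩
      2 * D * suc (∑ (subsets n) V′)       ≡⟨ cong (2 * D *_) vol≡ ⟨
      2 * D * ∑ (subsets n) V              <⟨ dense ⟩
      energy V                             ≤⟨ energy-remove V V′ x V≡ ⟩
      energy V′ + 2 * degree V x           ≤⟨ +-monoʳ-≤ (energy V′) (*-monoʳ-≤ 2 (<⇒≤ d<D)) ⟩
      energy V′ + 2 * D                    ∎)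
      where open ≤-Reasoning
    descend : ∀ fuel → ∑ (subsets n) V ≤ fuel → ∃ (Pruned D V)
    descend zero       vol≤ = contradiction (subst (_≤ 0) vol≡ vol≤) λ ()
    descend (suc fuel) vol≤ with W , W≤V′ , nonempty , minDegree ← prune fuel D V′ (s≤s⁻¹ (subst (_≤ suc fuel) vol≡ vol≤)) dense′ =
      W , (λ y → ≤-trans (W≤V′ y) (m∸n≤m (V y) (δ x y))) , nonempty , minDegree

  -- Growth of the number of reached sets

  module _ (V : Subset n → ℕ) (V≤1 : ∀ x → V x ≤ 1) (D : ℕ)
           (minDegree : ∀ x → 0 < V x → D ≤ degree V x) (s : Subset n) (0<Vs : 0 < V s) where

    reached : ℕ → ℕ
    reached i = ∑ (subsets m) (λ A → sized i A * V (s ⊕ ∂ A))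

    -- Of the at least D hyperedges leading from s ⊕ ∂ A into `V`, at most ∣ A ∣ lie in A already.
    -- Every other one can be inserted, and the endpoint moves along that edge.
    extensions : ∀ A → V (s ⊕ ∂ A) * (D ∸ ∣ A ∣) ≤
      ∑ (fins m) (λ c → 𝟙 (not (lookup A c)) * V (s ⊕ ∂ (A [ c ]≔ true)))
    extensions A with V (s ⊕ ∂ A) in eq
    ... | zero  = z≤n
    ... | suc w = begin
      suc w * (D ∸ ∣ A ∣)   ≤⟨ *-monoˡ-≤ (D ∸ ∣ A ∣) (subst (_≤ 1) eq (V≤1 (s ⊕ ∂ A))) ⟩
      1 * (D ∸ ∣ A ∣)       ≡⟨ *-identityˡ _ ⟩
      D ∸ ∣ A ∣             ≤⟨ m≤n+o⇒m∸n≤o D ∣ A ∣ D≤ ⟩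
      ∑ (fins m) (λ c → 𝟙 (not (lookup A c)) * V (s ⊕ ∂ (A [ c ]≔ true))) ∎
      where
      open ≤-Reasoning
      either : ∀ c → V (s ⊕ ∂ A ⊕ e c) ≤ 𝟙 (lookup A c) + 𝟙 (not (lookup A c)) * V (s ⊕ ∂ (A [ c ]≔ true))
      either c with lookup A c in Ac
      ... | true  = ≤-trans (V≤1 _) (m≤m+n 1 _)
      ... | false = ≤-reflexive (trans (cong V (trans (⊕-assoc s (∂ A) (e c)) (cong (s ⊕_) (sym (∂-insert A c Ac)))))
                                       (sym (+-identityʳ _)))
      D≤ : D ≤ ∣ A ∣ + ∑ (fins m) (λ c → 𝟙 (not (lookup A c)) * V (s ⊕ ∂ (A [ c ]≔ true)))
      D≤ = begin
        D                                   ≤⟨ minDegree (s ⊕ ∂ A) (subst (0 <_) (sym eq) z<s) ⟩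
        degree V (s ⊕ ∂ A)                  ≤⟨ ∑-mono-≤ (fins m) either ⟩
        _                                   ≡⟨ ∑-+ (fins m) _ _ ⟩
        _                                   ≡⟨ cong (_+ ∑ (fins m) (λ c → 𝟙 (not (lookup A c)) * V (s ⊕ ∂ (A [ c ]≔ true)))) (∑-𝟙-lookup A) ⟩
        ∣ A ∣ + _                           ∎

    -- Double counting of the pairs (A, c) with c ∉ A against the pairs (A ∪ {c}, c).
    reached-suc : ∀ i → reached i * (D ∸ i) ≤ suc i * reached (suc i)
    reached-suc i = begin
      reached i * (D ∸ i)
        ≡⟨ *-comm (reached i) (D ∸ i) ⟩
      (D ∸ i) * reached i
        ≡⟨ ∑-*ˡ (subsets m) (D ∸ i) _ ⟨
      ∑ (subsets m) (λ A → (D ∸ i) * (sized i A * V (s ⊕ ∂ A)))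
        ≤⟨ ∑-mono-≤ (subsets m) extend ⟩
      ∑ (subsets m) (λ A → ∑ (fins m) (λ c → 𝟙 (not (lookup A c)) * h (A [ c ]≔ true)))
        ≡⟨ ∑-swap (subsets m) (fins m) _ ⟩
      ∑ (fins m) (λ c → ∑ (subsets m) (λ A → 𝟙 (not (lookup A c)) * h (A [ c ]≔ true)))
        ≡⟨ ∑-cong (fins m) (λ c → ∑-insert c h) ⟩
      ∑ (fins m) (λ c → ∑ (subsets m) (λ B → 𝟙 (lookup B c) * h B))
        ≡⟨ ∑-swap (fins m) (subsets m) _ ⟩
      ∑ (subsets m) (λ B → ∑ (fins m) (λ c → 𝟙 (lookup B c) * h B))
        ≡⟨ ∑-cong (subsets m) collect ⟩
      ∑ (subsets m) (λ B → suc i * h B)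
        ≡⟨ ∑-*ˡ (subsets m) (suc i) h ⟩
      suc i * reached (suc i) ∎
      where
      open ≤-Reasoning
      h : Subset m → ℕ
      h B = sized (suc i) B * V (s ⊕ ∂ B)
      insert-h : ∀ A c → sized i A * (𝟙 (not (lookup A c)) * V (s ⊕ ∂ (A [ c ]≔ true))) ≡ 𝟙 (not (lookup A c)) * h (A [ c ]≔ true)
      insert-h A c with lookup A c in Ac
      ... | true  = *-zeroʳ (sized i A)
      ... | false rewrite ∣insert∣ A c Ac = rearrange (sized i A) _
        where
        rearrange : ∀ a b → a * (1 * b) ≡ 1 * (a * b)
        rearrange = solve-∀
      commute : ∀ a b c → a * (b * c) ≡ b * (c * a)
      commute = solve-∀
      extend : ∀ A → (D ∸ i) * (sized i A * V (s ⊕ ∂ A)) ≤ ∑ (fins m) (λ c → 𝟙 (not (lookup A c)) * h (A [ c ]≔ true))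
      extend A = begin
        (D ∸ i) * (sized i A * V (s ⊕ ∂ A))     ≡⟨ commute (D ∸ i) (sized i A) _ ⟩
        sized i A * (V (s ⊕ ∂ A) * (D ∸ i))     ≤⟨ κ-mono ∣ A ∣ i (λ { refl → extensions A }) ⟩
        sized i A * ∑ (fins m) (λ c → 𝟙 (not (lookup A c)) * V (s ⊕ ∂ (A [ c ]≔ true)))
                                                ≡⟨ ∑-*ˡ (fins m) (sized i A) _ ⟨
        _                                       ≡⟨ ∑-cong (fins m) (insert-h A) ⟩
        ∑ (fins m) (λ c → 𝟙 (not (lookup A c)) * h (A [ c ]≔ true)) ∎
      collect : ∀ B → ∑ (fins m) (λ c → 𝟙 (lookup B c) * h B) ≡ suc i * h B
      collect B = begin-equality
        ∑ (fins m) (λ c → 𝟙 (lookup B c) * h B)   ≡⟨ ∑-cong (fins m) (λ c → *-comm (𝟙 (lookup B c)) (h B)) ⟩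
        ∑ (fins m) (λ c → h B * 𝟙 (lookup B c))   ≡⟨ ∑-*ˡ (fins m) (h B) _ ⟩
        h B * ∑ (fins m) (λ c → 𝟙 (lookup B c))   ≡⟨ cong (h B *_) (∑-𝟙-lookup B) ⟩
        sized (suc i) B * V (s ⊕ ∂ B) * ∣ B ∣       ≡⟨ reorder (sized (suc i) B) _ ∣ B ∣ ⟩
        -- A set of size i + 1 arises once for each of its elements as the one inserted last.
        sized (suc i) B * ∣ B ∣ * V (s ⊕ ∂ B)       ≡⟨ cong (_* V (s ⊕ ∂ B)) (κ-subst ∣ B ∣ (suc i)) ⟩
        suc i * sized (suc i) B * V (s ⊕ ∂ B)       ≡⟨ *-assoc (suc i) (sized (suc i) B) _ ⟩
        suc i * h B                               ∎
        where
        reorder : ∀ a b c → a * b * c ≡ a * c * b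
        reorder = solve-∀

    reached-zero : 1 ≤ reached 0
    reached-zero = begin
      1                           ≤⟨ 0<Vs ⟩
      V s                         ≡⟨ cong V (trans (cong (s ⊕_) ∂-⊥) (⊕-identityʳ s)) ⟨
      V (s ⊕ ∂ ⊥)                 ≡⟨ *-identityˡ _ ⟨
      1 * V (s ⊕ ∂ ⊥)             ≡⟨ cong (λ a → κ a 0 * V (s ⊕ ∂ ⊥)) (∣⊥∣≡0 m) ⟨
      sized 0 (⊥ {m}) * V (s ⊕ ∂ ⊥) ≤⟨ ≤-∑-subsets (λ A → sized 0 A * V (s ⊕ ∂ A)) ⊥ ⟩
      reached 0                   ∎
      where open ≤-Reasoning

    reached-grows : ∀ i → 6 * i ≤ D → 5 ^ i ≤ reached i
    reached-grows zero    _    = reached-zero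
    reached-grows (suc i) 6i≤D = *-cancelˡ-≤ (suc i) (begin
      suc i * (5 * 5 ^ i)       ≡⟨ reorder i (5 ^ i) ⟩
      5 ^ i * (5 * suc i)       ≤⟨ *-mono-≤ (reached-grows i (≤-trans (*-monoʳ-≤ 6 (n≤1+n i)) 6i≤D)) 5[1+i]≤D∸i ⟩
      reached i * (D ∸ i)       ≤⟨ reached-suc i ⟩
      suc i * reached (suc i)   ∎)
      where
      open ≤-Reasoning
      reorder : ∀ i a → suc i * (5 * a) ≡ a * (5 * suc i)
      reorder = solve-∀
      regroup : ∀ i → suc (5 * suc i + i) ≡ 6 * suc i
      regroup = solve-∀
      -- The hypothesis at i + 1 gives 5 (i + 1) + i < 6 (i + 1) ≤ D, hence a growth factor of at
      -- least 5.
      5[1+i]≤D∸i : 5 * suc i ≤ D ∸ i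
      5[1+i]≤D∸i = m+n≤o⇒m≤o∸n (5 * suc i) (≤-trans (≤-trans (n≤1+n _) (≤-reflexive (regroup i))) 6i≤D)

    -- Group the sets by their endpoint x = s ⊕ ∂ A: without collisions each x in `V` is the
    -- endpoint of at most one set of size ℓ.
    reached≤ : ∀ ℓ → (∀ A B → ∣ A ∣ ≡ ℓ → ∣ B ∣ ≡ ℓ → ∂ A ≡ ∂ B → A ≡ B) →
      reached ℓ ≤ ∑ (subsets n) V
    reached≤ ℓ ∂-inj = begin
      reached ℓ
        ≡⟨ ∑-cong (subsets m) (λ A → cong (sized ℓ A *_) (∑-δ (s ⊕ ∂ A) V)) ⟨
      ∑ (subsets m) (λ A → sized ℓ A * ∑ (subsets n) (λ x → δ (s ⊕ ∂ A) x * V x))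
        ≡⟨ ∑-cong (subsets m) (λ A → ∑-*ˡ (subsets n) (sized ℓ A) _) ⟨
      ∑ (subsets m) (λ A → ∑ (subsets n) (λ x → sized ℓ A * (δ (s ⊕ ∂ A) x * V x)))
        ≡⟨ ∑-swap (subsets m) (subsets n) _ ⟩
      ∑ (subsets n) (λ x → ∑ (subsets m) (λ A → sized ℓ A * (δ (s ⊕ ∂ A) x * V x)))
        ≡⟨ ∑-cong (subsets n) (λ x → trans (∑-cong (subsets m) (λ A → reorder (sized ℓ A) _ (V x))) (∑-*ˡ (subsets m) (V x) _)) ⟩
      ∑ (subsets n) (λ x → V x * ∑ (subsets m) (hits x))
        ≤⟨ ∑-mono-≤ (subsets n) (λ x → *-monoʳ-≤ (V x) (∑-subsingleton (hits x) (hits≤1 x) (hits-unique x))) ⟩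
      ∑ (subsets n) (λ x → V x * 1)
        ≡⟨ ∑-cong (subsets n) (λ x → *-identityʳ (V x)) ⟩
      ∑ (subsets n) V ∎
      where
      open ≤-Reasoning
      reorder : ∀ a b c → a * (b * c) ≡ c * (a * b)
      reorder = solve-∀
      hits : Subset n → Subset m → ℕ
      hits x A = sized ℓ A * δ (s ⊕ ∂ A) x
      hits≤1 : ∀ x A → hits x A ≤ 1
      hits≤1 x A = *-mono-≤ (κ≤1 ∣ A ∣ ℓ) (δ≤1 (s ⊕ ∂ A) x)
      hits-unique : ∀ x A B → 0 < hits x A → 0 < hits x B → A ≡ B
      hits-unique x A B p q = ∂-inj A B (κ-≡ _ ℓ (0<m*n⇒0<m _ p)) (κ-≡ _ ℓ (0<m*n⇒0<m _ q))
        (⊕-cancelˡ s (∂ A) (∂ B) (trans (δ-≡ _ x (0<m*n⇒0<n (sized ℓ A) p)) (sym (δ-≡ _ x (0<m*n⇒0<n (sized ℓ B) q)))))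

-- Binomial coefficients

-- binom u v is the binomial coefficient C(u + v, u).
binom : ℕ → ℕ → ℕ
binom zero    v       = 1
binom (suc u) zero    = 1
binom (suc u) (suc v) = binom u (suc v) + binom (suc u) v

binom-zeroʳ : ∀ u → binom u 0 ≡ 1
binom-zeroʳ zero    = refl
binom-zeroʳ (suc u) = refl

-- The two absorption identities are proved together: Pascal's rule reduces either one to both of
-- them at smaller arguments.
binom-sucˡ : ∀ u v → suc u * binom (suc u) v ≡ suc (u + v) * binom u v
binom-sucʳ : ∀ u v → suc v * binom u (suc v) ≡ suc (u + v) * binom u v

binom-sucˡ u zero    = trans (cong (λ t → suc t * 1) (sym (+-identityʳ u))) (cong (suc (u + 0) *_) (sym (binom-zeroʳ u)))
binom-sucˡ u (suc v) = begin
  suc u * (binom u (suc v) + binom (suc u) v)          ≡⟨ *-distribˡ-+ (suc u) (binom u (suc v)) (binom (suc u) v) ⟩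
  suc u * binom u (suc v) + suc u * binom (suc u) v    ≡⟨ cong (suc u * binom u (suc v) +_) (trans (binom-sucˡ u v) (sym (binom-sucʳ u v))) ⟩
  suc u * binom u (suc v) + suc v * binom u (suc v)    ≡⟨ *-distribʳ-+ (binom u (suc v)) (suc u) (suc v) ⟨
  suc (u + suc v) * binom u (suc v)                    ∎
  where open ≡-Reasoning

binom-sucʳ zero    v = refl
binom-sucʳ (suc u) v = begin
  suc v * (binom u (suc v) + binom (suc u) v)          ≡⟨ *-distribˡ-+ (suc v) (binom u (suc v)) (binom (suc u) v) ⟩
  suc v * binom u (suc v) + suc v * binom (suc u) v    ≡⟨ cong (_+ suc v * binom (suc u) v) (trans (binom-sucʳ u v) (sym (binom-sucˡ u v))) ⟩
  suc u * binom (suc u) v + suc v * binom (suc u) v    ≡⟨ *-distribʳ-+ (binom (suc u) v) (suc u) (suc v) ⟨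
  (suc u + suc v) * binom (suc u) v                    ≡⟨ cong (_* binom (suc u) v) (cong suc (+-suc u v)) ⟩
  suc (suc u + v) * binom (suc u) v                    ∎
  where open ≡-Reasoning

binom-suc-suc : ∀ u v → suc u * suc v * binom (suc u) (suc v) ≡ (2 + u + v) * suc (u + v) * binom u v
binom-suc-suc u v = begin
  suc u * suc v * binom (suc u) (suc v)     ≡⟨ reorder (suc u) (suc v) _ ⟩
  suc v * (suc u * binom (suc u) (suc v))   ≡⟨ cong (suc v *_) (binom-sucˡ u (suc v)) ⟩
  suc v * (suc (u + suc v) * binom u (suc v)) ≡⟨ reorder′ (suc v) (suc (u + suc v)) _ ⟩
  suc (u + suc v) * (suc v * binom u (suc v)) ≡⟨ cong₂ _*_ (cong suc (+-suc u v)) (binom-sucʳ u v) ⟩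
  (2 + u + v) * (suc (u + v) * binom u v)   ≡⟨ *-assoc (2 + u + v) (suc (u + v)) (binom u v) ⟨
  (2 + u + v) * suc (u + v) * binom u v     ∎
  where
  open ≡-Reasoning
  reorder : ∀ a b c → a * b * c ≡ b * (a * c)
  reorder = solve-∀
  reorder′ : ∀ a b c → a * (b * c) ≡ b * (a * c)
  reorder′ = solve-∀

0<binom : ∀ u v → 0 < binom u v
0<binom zero    v       = z<s
0<binom (suc u) zero    = z<s
0<binom (suc u) (suc v) = ≤-trans (0<binom u (suc v)) (m≤m+n _ _)

binom≤ : ∀ u v → binom u v ≤ (u + v) ^ u
binom≤ zero    v       = ≤-refl
binom≤ (suc u) zero    = m^n>0 (suc u + 0) (suc u)
binom≤ (suc u) (suc v) = begin
  binom u (suc v) + binom (suc u) v           ≤⟨ +-mono-≤ (binom≤ u (suc v)) (binom≤ (suc u) v) ⟩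
  (u + suc v) ^ u + (suc u + v) ^ suc u       ≤⟨ +-mono-≤ (^-monoˡ-≤ u (n≤1+n (u + suc v)))
                                                   (*-mono-≤ (≤-reflexive (sym (+-suc u v))) (^-monoˡ-≤ u (≤-trans (≤-reflexive (sym (+-suc u v))) (n≤1+n _)))) ⟩
  (suc u + suc v) ^ u + (u + suc v) * (suc u + suc v) ^ u ∎
  where open ≤-Reasoning

-- With r = a + i + 1 and n fixed, passing from i to i + 1 lowers the probability in
-- `binom-balanced` by a factor no worse than r/n. Once `binom-suc-suc` removes the binomials of the
-- larger arguments, this is the product of the elementary inequalities `h₁`, `h₂` and `h₃`.
binom-ratio : ∀ i a b → suc i ≤ a → a ≤ b →
  binom i i * binom (suc a) (suc b) * (a + suc i) ≤
  binom (suc i) (suc i) * binom a b * (a + suc i + (b + suc i))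
binom-ratio i a b i<a a≤b = *-cancelˡ-≤ (suc i * suc i * (suc a * suc b)) (begin
  suc i * suc i * (suc a * suc b) * (Y * Q * r)
    ≡⟨ e₁ (suc i) (suc a * suc b) Y Q r ⟩
  suc i * suc i * r * Y * (suc a * suc b * Q)
    ≡⟨ cong (suc i * suc i * r * Y *_) (binom-suc-suc a b) ⟩
  suc i * suc i * r * Y * ((2 + a + b) * suc (a + b) * P)
    ≡⟨ e₂ (suc i) r Y (2 + a + b) (suc (a + b)) P ⟩
  (suc i * r) * (suc i * (2 + a + b)) * suc (a + b) * (Y * P)
    ≤⟨ *-monoˡ-≤ (Y * P) (*-mono-≤ (*-mono-≤ h₁ h₂) h₃) ⟩
  (suc (i + i) * suc a) * ((2 + i + i) * suc b) * n * (Y * P)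
    ≡⟨ e₃ (suc (i + i)) (suc a) (2 + i + i) (suc b) n Y P ⟩
  suc a * suc b * n * P * ((2 + i + i) * suc (i + i) * Y)
    ≡⟨ cong (suc a * suc b * n * P *_) (binom-suc-suc i i) ⟨
  suc a * suc b * n * P * (suc i * suc i * X)
    ≡⟨ e₄ (suc a * suc b) n P (suc i * suc i) X ⟩
  suc i * suc i * (suc a * suc b) * (X * P * n) ∎)
  where
  open ≤-Reasoning
  X = binom (suc i) (suc i)
  Y = binom i i
  P = binom a b
  Q = binom (suc a) (suc b)
  r = a + suc i
  n = a + suc i + (b + suc i)
  e₁ : ∀ i c Y Q r → i * i * c * (Y * Q * r) ≡ i * i * r * Y * (c * Q)
  e₁ = solve-∀
  e₂ : ∀ i r Y c d P → i * i * r * Y * (c * d * P) ≡ (i * r) * (i * c) * d * (Y * P)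
  e₂ = solve-∀
  e₃ : ∀ c d e f n Y P → (c * d) * (e * f) * n * (Y * P) ≡ d * f * n * P * (e * c * Y)
  e₃ = solve-∀
  e₄ : ∀ c n P i X → c * n * P * (i * X) ≡ i * c * (X * P * n)
  e₄ = solve-∀
  f₁ : ∀ i a → suc i * (a + suc i) ≡ i * i + (i * a + a + 2 * i + 1)
  f₁ = solve-∀
  f₁′ : ∀ i a → i * a + (i * a + a + 2 * i + 1) ≡ suc (i + i) * suc a
  f₁′ = solve-∀
  -- The two sides differ exactly by i a - i i, which is where i ≤ a enters.
  h₁ : suc i * r ≤ suc (i + i) * suc a
  h₁ = begin
    suc i * r                                ≡⟨ f₁ i a ⟩
    i * i + (i * a + a + 2 * i + 1)          ≤⟨ +-monoˡ-≤ _ (*-monoʳ-≤ i (≤-trans (n≤1+n i) i<a)) ⟩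
    i * a + (i * a + a + 2 * i + 1)          ≡⟨ f₁′ i a ⟩
    suc (i + i) * suc a                      ∎
  f₂ : ∀ i b → suc i * (2 + b + b) ≡ (2 + i + i) * suc b
  f₂ = solve-∀
  h₂ : suc i * (2 + a + b) ≤ (2 + i + i) * suc b
  h₂ = ≤-trans (*-monoʳ-≤ (suc i) (+-monoˡ-≤ b (+-monoʳ-≤ 2 a≤b))) (≤-reflexive (f₂ i b))
  f₃ : ∀ i a b → suc (a + b) + (i + suc i) ≡ a + suc i + (b + suc i)
  f₃ = solve-∀
  h₃ : suc (a + b) ≤ n
  h₃ = ≤-trans (m≤m+n _ _) (≤-reflexive (f₃ i a b))

-- A uniformly random set of size a + i in a universe of size n = a + b + 2i meets a given
-- set of size 2i in exactly i points with probability at least ((a + i)/n)^i.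
binom-balanced : ∀ i a b → i ≤ a → a ≤ b →
  binom (a + i) (b + i) * (a + i) ^ i ≤ binom i i * binom a b * (a + i + (b + i)) ^ i
binom-balanced zero    a b _   _   rewrite +-identityʳ a | +-identityʳ b = ≤-reflexive (cong (_* 1) (sym (*-identityˡ (binom a b))))
binom-balanced (suc i) a b i<a a≤b = begin
  N * (r * r ^ i)             ≡⟨ e₁ N r (r ^ i) ⟩
  N * r ^ i * r               ≤⟨ *-monoˡ-≤ r previous ⟩
  Y * Q * n ^ i * r           ≡⟨ e₂ (Y * Q) (n ^ i) r ⟩
  n ^ i * (Y * Q * r)         ≤⟨ *-monoʳ-≤ (n ^ i) (binom-ratio i a b i<a a≤b) ⟩
  n ^ i * (X * P * n)         ≡⟨ e₃ (n ^ i) (X * P) n ⟩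
  X * P * (n * n ^ i)         ∎
  where
  open ≤-Reasoning
  X = binom (suc i) (suc i)
  Y = binom i i
  P = binom a b
  Q = binom (suc a) (suc b)
  r = a + suc i
  n = a + suc i + (b + suc i)
  N = binom (a + suc i) (b + suc i)
  e₁ : ∀ a b c → a * (b * c) ≡ a * c * b
  e₁ = solve-∀
  e₂ : ∀ a b c → a * b * c ≡ b * (a * c)
  e₂ = solve-∀
  e₃ : ∀ a b c → a * (b * c) ≡ b * (c * a)
  e₃ = solve-∀
  previous : N * r ^ i ≤ Y * Q * n ^ i
  -- Lowering i while raising a and b keeps the size r of the random set and the universe n
  -- unchanged.
  previous with binom-balanced i (suc a) (suc b) (≤-trans (n≤1+n i) (≤-trans i<a (n≤1+n a))) (s≤s a≤b)
  ... | p rewrite +-suc a i | +-suc b i = p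

-- Counting subsets by size

∑-sized : ∀ r s → ∑ (subsets (r + s)) (sized r) ≤ binom r s
∑-sized r s = bound (r + s) r s refl
  where
  oversized : ∀ {n a} → n < a → ∀ (x : Subset n) → sized a x ≤ 0
  oversized {n} {a} n<a x with sized a x in eq
  ... | zero  = z≤n
  ... | suc _ = contradiction (subst (_≤ n) (κ-≡ ∣ x ∣ a (subst (0 <_) (sym eq) z<s)) (∣p∣≤n x)) (<⇒≱ n<a)
  -- Keeping n apart from r + s lets the induction remove one element on either side of Pascal's
  -- rule.
  bound : ∀ n r s → n ≡ r + s → ∑ (subsets n) (sized r) ≤ binom r s
  bound zero    zero    zero    _  = ≤-refl
  bound (suc n) zero    (suc s) eq = begin
    ∑ (subsets (suc n)) (sized 0)                  ≡⟨ ∑-subsets-suc n _ ⟩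
    ∑ (subsets n) (sized 0) + ∑ (subsets n) (λ _ → 0) ≤⟨ +-mono-≤ (bound n 0 s (suc-injective eq)) (≤-reflexive (∑-zero (subsets n))) ⟩
    1 ∎
    where open ≤-Reasoning
  bound (suc n) (suc r) zero    eq = begin
    ∑ (subsets (suc n)) (sized (suc r))            ≡⟨ ∑-subsets-suc n _ ⟩
    ∑ (subsets n) (sized (suc r)) + ∑ (subsets n) (sized r)
      ≤⟨ +-mono-≤ (≤-trans (∑-mono-≤ (subsets n) (oversized n<1+r)) (≤-reflexive (∑-zero (subsets n))))
                  (bound n r 0 (suc-injective eq)) ⟩
    binom r 0                                      ≡⟨ binom-zeroʳ r ⟩
    1 ∎
    where
    open ≤-Reasoning
    n<1+r : n < suc r
    n<1+r = s≤s (≤-reflexive (trans (suc-injective eq) (+-identityʳ r)))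
  bound (suc n) (suc r) (suc s) eq = begin
    ∑ (subsets (suc n)) (sized (suc r))            ≡⟨ ∑-subsets-suc n _ ⟩
    ∑ (subsets n) (sized (suc r)) + ∑ (subsets n) (sized r)
      ≤⟨ +-mono-≤ (bound n (suc r) s (trans (suc-injective eq) (+-suc r s))) (bound n r (suc s) (suc-injective eq)) ⟩
    binom (suc r) s + binom r (suc s)              ≡⟨ +-comm (binom (suc r) s) _ ⟩
    binom (suc r) (suc s) ∎
    where open ≤-Reasoning

-- Consider the sets x with u points inside c and w outside: adding c exchanges the u points for the
-- other v, so x has size u + w and x ⊕ c has size v + w. The application has u = v, but removing
-- one point of c breaks this balance, hence the separate parameters.
∑-sized-pairs : ∀ {n} (c : Subset n) u v w z → ∣ c ∣ ≡ u + v → ∣ ∁ c ∣ ≡ w + z →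
  binom u v * binom w z ≤ ∑ (subsets n) (λ x → sized (u + w) x * sized (v + w) (x ⊕ c))
∑-sized-pairs [] zero zero zero zero _ _ = ≤-refl
∑-sized-pairs {suc n} (true ∷ c) zero (suc v) w z p q = begin
  1 * binom w z                           ≤⟨ ∑-sized-pairs c zero v w z (suc-injective p) q ⟩
  _                                       ≤⟨ m≤m+n _ _ ⟩
  _                                       ≡⟨ ∑-subsets-suc n _ ⟨
  _                                       ∎
  where open ≤-Reasoning
∑-sized-pairs {suc n} (true ∷ c) (suc u) zero w z p q = begin
  1 * binom w z                           ≡⟨ cong (_* binom w z) (binom-zeroʳ u) ⟨
  binom u 0 * binom w z                   ≤⟨ ∑-sized-pairs c u zero w z (suc-injective p) q ⟩
  _                                       ≤⟨ m≤n+m _ _ ⟩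
  _                                       ≡⟨ ∑-subsets-suc n _ ⟨
  _                                       ∎
  where open ≤-Reasoning
∑-sized-pairs {suc n} (true ∷ c) (suc u) (suc v) w z p q = begin
  (binom u (suc v) + binom (suc u) v) * binom w z
    ≡⟨ trans (*-distribʳ-+ (binom w z) (binom u (suc v)) _) (+-comm (binom u (suc v) * binom w z) _) ⟩
  binom (suc u) v * binom w z + binom u (suc v) * binom w z
    ≤⟨ +-mono-≤ (∑-sized-pairs c (suc u) v w z (trans (suc-injective p) (+-suc u v)) q)
                (∑-sized-pairs c u (suc v) w z (suc-injective p) q) ⟩
  _ ≡⟨ ∑-subsets-suc n _ ⟨
  _ ∎
  where open ≤-Reasoning
∑-sized-pairs {suc n} (false ∷ c) u v zero (suc z) p q = begin
  binom u v * 1                           ≤⟨ ∑-sized-pairs c u v zero z p (suc-injective q) ⟩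
  _                                       ≤⟨ m≤m+n _ _ ⟩
  _                                       ≡⟨ ∑-subsets-suc n _ ⟨
  _                                       ∎
  where open ≤-Reasoning
∑-sized-pairs {suc n} (false ∷ c) u v (suc w) zero p q rewrite +-suc u w | +-suc v w = begin
  binom u v * 1                           ≡⟨ cong (binom u v *_) (binom-zeroʳ w) ⟨
  binom u v * binom w 0                   ≤⟨ ∑-sized-pairs c u v w zero p (suc-injective q) ⟩
  _                                       ≤⟨ m≤n+m _ _ ⟩
  _                                       ≡⟨ ∑-subsets-suc n _ ⟨
  _                                       ∎
  where open ≤-Reasoning
∑-sized-pairs {suc n} (false ∷ c) u v (suc w) (suc z) p q
  with ∑-sized-pairs c u v (suc w) z p (trans (suc-injective q) (+-suc w z))
... | outside-half rewrite +-suc u w | +-suc v w = begin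
  binom u v * (binom w (suc z) + binom (suc w) z)
    ≡⟨ trans (*-distribˡ-+ (binom u v) (binom w (suc z)) _) (+-comm (binom u v * binom w (suc z)) _) ⟩
  binom u v * binom (suc w) z + binom u v * binom w (suc z)
    ≤⟨ +-mono-≤ outside-half (∑-sized-pairs c u v w (suc z) p (suc-injective q)) ⟩
  _ ≡⟨ ∑-subsets-suc n _ ⟨
  _ ∎
  where open ≤-Reasoning

-- Bounding the exponential series

ι : ℕ → ℚ
ι k = pos k / 1

toℚᵘ-/ : ∀ a b → toℚᵘ (pos a / suc b) ℚᵘ.≃ ℚᵘ.mkℚᵘ (pos a) b
toℚᵘ-/ a b = ℚ.toℚᵘ-fromℚᵘ (ℚᵘ.mkℚᵘ (pos a) b)

/-*-ι : ∀ a b → (pos a / suc b) ℚ.* ι (suc b) ≡ ι a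
/-*-ι a b = ℚ.toℚᵘ-injective (begin
  toℚᵘ ((pos a / suc b) ℚ.* ι (suc b))                  ≈⟨ ℚ.toℚᵘ-homo-* (pos a / suc b) (ι (suc b)) ⟩
  toℚᵘ (pos a / suc b) ℚᵘ.* toℚᵘ (ι (suc b))            ≈⟨ ℚᵘ.*-cong (toℚᵘ-/ a b) (toℚᵘ-/ (suc b) 0) ⟩
  ℚᵘ.mkℚᵘ (pos a) b ℚᵘ.* ℚᵘ.mkℚᵘ (pos (suc b)) 0            ≈⟨ ℚᵘ.*≡* cross ⟩
  ℚᵘ.mkℚᵘ (pos a) 0                                     ≈⟨ toℚᵘ-/ a 0 ⟨
  toℚᵘ (ι a)                                          ∎)
  where
  open import Relation.Binary.Reasoning.Setoid ℚᵘ.≃-setoid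
  cross : (pos a ℤ.* pos (suc b)) ℤ.* pos 1 ≡ pos a ℤ.* pos (suc (b * 1))
  cross = trans (ℤ.*-identityʳ (pos a ℤ.* pos (suc b))) (cong (λ t → pos a ℤ.* pos (suc t)) (sym (*-identityʳ b)))

ι-* : ∀ a b → ι (a * b) ≡ ι a ℚ.* ι b
ι-* a b = ℚ.toℚᵘ-injective (begin
  toℚᵘ (ι (a * b))                          ≈⟨ toℚᵘ-/ (a * b) 0 ⟩
  ℚᵘ.mkℚᵘ (pos (a * b)) 0                     ≈⟨ ℚᵘ.*≡* (cong (ℤ._* pos 1) (ℤ.pos-* a b)) ⟩
  ℚᵘ.mkℚᵘ (pos a) 0 ℚᵘ.* ℚᵘ.mkℚᵘ (pos b) 0      ≈⟨ ℚᵘ.*-cong (toℚᵘ-/ a 0) (toℚᵘ-/ b 0) ⟨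
  toℚᵘ (ι a) ℚᵘ.* toℚᵘ (ι b)                ≈⟨ ℚ.toℚᵘ-homo-* (ι a) (ι b) ⟨
  toℚᵘ (ι a ℚ.* ι b)                        ∎)
  where open import Relation.Binary.Reasoning.Setoid ℚᵘ.≃-setoid

ι-+ : ∀ a b → ι (a + b) ≡ ι a ℚ.+ ι b
ι-+ a b = ℚ.toℚᵘ-injective (begin
  toℚᵘ (ι (a + b))                          ≈⟨ toℚᵘ-/ (a + b) 0 ⟩
  ℚᵘ.mkℚᵘ (pos (a + b)) 0                     ≈⟨ ℚᵘ.*≡* (cong (ℤ._* pos 1) (cong₂ ℤ._+_ (sym (ℤ.*-identityʳ (pos a))) (sym (ℤ.*-identityʳ (pos b))))) ⟩
  ℚᵘ.mkℚᵘ (pos a) 0 ℚᵘ.+ ℚᵘ.mkℚᵘ (pos b) 0      ≈⟨ ℚᵘ.+-cong (toℚᵘ-/ a 0) (toℚᵘ-/ b 0) ⟨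
  toℚᵘ (ι a) ℚᵘ.+ toℚᵘ (ι b)                ≈⟨ ℚ.toℚᵘ-homo-+ (ι a) (ι b) ⟨
  toℚᵘ (ι a ℚ.+ ι b)                        ∎)
  where open import Relation.Binary.Reasoning.Setoid ℚᵘ.≃-setoid

ι-mono-≤ : ∀ {a b} → a ≤ b → ι a ℚ.≤ ι b
ι-mono-≤ {a} {b} a≤b = ℚ.toℚᵘ-cancel-≤ (begin
  toℚᵘ (ι a)         ≃⟨ toℚᵘ-/ a 0 ⟩
  ℚᵘ.mkℚᵘ (pos a) 0    ≤⟨ ℚᵘ.*≤* (ℤ.*-monoʳ-≤-nonNeg (pos 1) (ℤ.+≤+ a≤b)) ⟩
  ℚᵘ.mkℚᵘ (pos b) 0    ≃⟨ toℚᵘ-/ b 0 ⟨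
  toℚᵘ (ι b)         ∎)
  where open ℚᵘ.≤-Reasoning

ι-cancel-< : ∀ {a b} → ι a ℚ.< ι b → a < b
ι-cancel-< ιa<ιb = ≰⇒> (λ b≤a → ℚ.<-irrefl refl (ℚ.<-≤-trans ιa<ιb (ι-mono-≤ b≤a)))

ι-nonNeg : ∀ k → ℚ.NonNegative (ι k)
ι-nonNeg k = ℚ.nonNegative (ι-mono-≤ {0} {k} z≤n)

ι-pos : ∀ k .{{_ : NonZero k}} → ℚ.Positive (ι k)
ι-pos (suc k) = ℚ.positive (ℚ.<-≤-trans (ℚ.positive⁻¹ 1ℚ) (ι-mono-≤ {1} {suc k} (s≤s z≤n)))

4^≡2^*2^ : ∀ i → 4 ^ i ≡ 2 ^ i * 2 ^ i
4^≡2^*2^ i = begin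
  4 ^ i               ≡⟨ ^-*-assoc 2 2 i ⟩
  2 ^ (2 * i)         ≡⟨ cong (λ a → 2 ^ (i + a)) (+-identityʳ i) ⟩
  2 ^ (i + i)         ≡⟨ ^-distribˡ-+-* 2 i i ⟩
  2 ^ i * 2 ^ i       ∎
  where open ≡-Reasoning

-- The product (x + 1)⋯(x + i) lies above x^i and equals i! C(x + i, i), which is at most i! 2^(x +
-- i). The induction in `rising≤` is Pascal's rule with the factorials multiplied in.
^≤!*2^ : ∀ i x → x ^ i ≤ i ! * 2 ^ (x + i)
^≤!*2^ i x = ≤-trans (^≤rising i x) (rising≤ i x)
  where
  -- rising i x = (x + 1)(x + 2)⋯(x + i)
  rising : ℕ → ℕ → ℕ
  rising zero    x = 1
  rising (suc i) x = rising i x * (x + suc i)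
  ^≤rising : ∀ i x → x ^ i ≤ rising i x
  ^≤rising zero    x = ≤-refl
  ^≤rising (suc i) x = ≤-trans (≤-reflexive (*-comm x (x ^ i))) (*-mono-≤ (^≤rising i x) (m≤m+n x (suc i)))
  rising-shift : ∀ i x → suc x * rising i (suc x) ≡ rising (suc i) x
  rising-shift zero    x = trans (*-identityʳ (suc x)) (trans (sym (+-comm x 1)) (sym (*-identityˡ (x + 1))))
  rising-shift (suc i) x = begin
    suc x * (rising i (suc x) * (suc x + suc i))  ≡⟨ *-assoc (suc x) (rising i (suc x)) (suc x + suc i) ⟨
    suc x * rising i (suc x) * (suc x + suc i)    ≡⟨ cong₂ _*_ (rising-shift i x) (sym (+-suc x (suc i))) ⟩
    rising (suc i) x * (x + suc (suc i))          ∎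
    where open ≡-Reasoning
  rising≤ : ∀ i x → rising i x ≤ i ! * 2 ^ (x + i)
  rising≤ zero    x    = ≤-trans (m^n>0 2 (x + 0)) (≤-reflexive (sym (+-identityʳ (2 ^ (x + 0)))))
  rising≤ (suc i) zero = begin
    rising i 0 * suc i              ≤⟨ *-monoˡ-≤ (suc i) (rising≤ i 0) ⟩
    i ! * 2 ^ i * suc i             ≡⟨ reorder (i !) (2 ^ i) (suc i) ⟩
    suc i * i ! * 2 ^ i             ≤⟨ *-monoʳ-≤ (suc i * i !) (^-monoʳ-≤ 2 (n≤1+n i)) ⟩
    suc i * i ! * 2 ^ suc i         ∎
    where
    open ≤-Reasoning
    reorder : ∀ a b c → a * b * c ≡ c * a * b
    reorder = solve-∀
  rising≤ (suc i) (suc x) = begin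
    rising i (suc x) * (suc x + suc i)
      ≡⟨ split (rising i (suc x)) (suc x) (suc i) ⟩
    suc i * rising i (suc x) + suc x * rising i (suc x)
      ≡⟨ cong (λ a → suc i * rising i (suc x) + a) (rising-shift i x) ⟩
    suc i * rising i (suc x) + rising (suc i) x
      ≤⟨ +-mono-≤ (*-monoʳ-≤ (suc i) (rising≤ i (suc x))) (rising≤ (suc i) x) ⟩
    suc i * (i ! * 2 ^ (suc x + i)) + suc i * i ! * 2 ^ (x + suc i)
      ≡⟨ cong (λ t → suc i * (i ! * 2 ^ t) + suc i * i ! * 2 ^ (x + suc i)) (sym (+-suc x i)) ⟩
    suc i * (i ! * 2 ^ (x + suc i)) + suc i * i ! * 2 ^ (x + suc i)
      ≡⟨ double (suc i) (i !) (2 ^ (x + suc i)) ⟩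
    suc i * i ! * (2 * 2 ^ (x + suc i)) ∎
    where
    open ≤-Reasoning
    split : ∀ a b c → a * (b + c) ≡ c * a + b * a
    split = solve-∀
    double : ∀ a b c → a * (b * c) + a * b * c ≡ a * b * (2 * c)
    double = solve-∀

-- x^i / i! ≤ 2^(x + i) gives q^i / i! ≤ 2^x / 2^i for q ≤ x/4, a series with sum at most 2^(x + 1).
module _ {q : ℚ} .{{_ : ℚ.NonNegative q}} {x : ℕ} (q≤x/4 : q ℚ.* ι 4 ℚ.≤ ι x) where

  -- The left side is (4 q)^i; scaling by 4^i i! keeps the induction free of division.
  expTerm-* : ∀ i → expTerm q i ℚ.* ι (4 ^ i * i !) ℚ.≤ ι (x ^ i)
  expTerm-* zero    = ℚ.≤-refl
  expTerm-* (suc i) = begin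
    t ℚ.* q ℚ.* p ℚ.* ι (4 * 4 ^ i * (suc i * i !))
      ≡⟨ cong (t ℚ.* q ℚ.* p ℚ.*_) (trans (cong ι (regroup 4 (4 ^ i) (suc i) (i !)))
           (trans (ι-* (4 ^ i * i !) (4 * suc i)) (cong (ι (4 ^ i * i !) ℚ.*_) (ι-* 4 (suc i))))) ⟩
    t ℚ.* q ℚ.* p ℚ.* (ι (4 ^ i * i !) ℚ.* (ι 4 ℚ.* ι (suc i)))
      ≡⟨ shuffle t q p (ι (4 ^ i * i !)) (ι 4) (ι (suc i)) ⟩
    (t ℚ.* ι (4 ^ i * i !)) ℚ.* (q ℚ.* ι 4) ℚ.* (p ℚ.* ι (suc i))
      ≡⟨ cong ((t ℚ.* ι (4 ^ i * i !)) ℚ.* (q ℚ.* ι 4) ℚ.*_) (/-*-ι 1 i) ⟩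
    (t ℚ.* ι (4 ^ i * i !)) ℚ.* (q ℚ.* ι 4) ℚ.* 1ℚ
      ≡⟨ ℚ.*-identityʳ _ ⟩
    (t ℚ.* ι (4 ^ i * i !)) ℚ.* (q ℚ.* ι 4)
      ≤⟨ ℚ.*-monoʳ-≤-nonNeg (q ℚ.* ι 4) {{ℚ.nonNeg*nonNeg⇒nonNeg q (ι 4) {{ι-nonNeg 4}}}} (expTerm-* i) ⟩
    ι (x ^ i) ℚ.* (q ℚ.* ι 4)
      ≤⟨ ℚ.*-monoˡ-≤-nonNeg (ι (x ^ i)) {{ι-nonNeg (x ^ i)}} q≤x/4 ⟩
    ι (x ^ i) ℚ.* ι x
      ≡⟨ trans (sym (ι-* (x ^ i) x)) (cong ι (*-comm (x ^ i) x)) ⟩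
    ι (x * x ^ i) ∎
    where
    open ℚ.≤-Reasoning
    t = expTerm q i
    p = pos 1 / suc i
    regroup : ∀ a b c d → a * b * (c * d) ≡ b * d * (a * c)
    regroup = solve-∀
    shuffle : ∀ t q p u v w → t ℚ.* q ℚ.* p ℚ.* (u ℚ.* (v ℚ.* w)) ≡ (t ℚ.* u) ℚ.* (q ℚ.* v) ℚ.* (p ℚ.* w)
    shuffle = solve 6 (λ t q p u v w → t :* q :* p :* (u :* (v :* w)) := (t :* u) :* (q :* v) :* (p :* w)) refl
      where open +-*-Solver

  -- Of the two factors 2^i in 4^i, one cancels the 2^i in x^i ≤ i! 2^(x + i) and the other provides
  -- the geometric decay.
  expTerm≤ : ∀ i → expTerm q i ℚ.* ι (2 ^ i) ℚ.≤ ι (2 ^ x)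
  expTerm≤ i = ℚ.*-cancelʳ-≤-pos (ι (2 ^ i * i !)) {{ι-pos (2 ^ i * i !) {{m*n≢0 (2 ^ i) (i !) {{m^n≢0 2 i}} {{i !≢0}}}}}} (begin
    expTerm q i ℚ.* ι (2 ^ i) ℚ.* ι (2 ^ i * i !)
      ≡⟨ ℚ.*-assoc (expTerm q i) (ι (2 ^ i)) (ι (2 ^ i * i !)) ⟩
    expTerm q i ℚ.* (ι (2 ^ i) ℚ.* ι (2 ^ i * i !))
      ≡⟨ cong (expTerm q i ℚ.*_) (sym (ι-* (2 ^ i) (2 ^ i * i !))) ⟩
    expTerm q i ℚ.* ι (2 ^ i * (2 ^ i * i !))
      ≡⟨ cong (λ a → expTerm q i ℚ.* ι a) (trans (sym (*-assoc (2 ^ i) (2 ^ i) (i !)))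
           (cong (_* i !) (sym (4^≡2^*2^ i)))) ⟩
    expTerm q i ℚ.* ι (4 ^ i * i !)
      ≤⟨ expTerm-* i ⟩
    ι (x ^ i)
      ≤⟨ ι-mono-≤ (^≤!*2^ i x) ⟩
    ι (i ! * 2 ^ (x + i))
      ≡⟨ cong ι (trans (cong (i ! *_) (^-distribˡ-+-* 2 x i)) (reorder (i !) (2 ^ x) (2 ^ i))) ⟩
    ι (2 ^ x * (2 ^ i * i !))
      ≡⟨ ι-* (2 ^ x) (2 ^ i * i !) ⟩
    ι (2 ^ x) ℚ.* ι (2 ^ i * i !) ∎)
    where
    open ℚ.≤-Reasoning
    reorder : ∀ a b c → a * (b * c) ≡ b * (c * a)
    reorder = solve-∀

  -- Divided by 2^N, the summand 2^x is the remaining geometric tail. Carrying it along makes the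
  -- bound on the partial sums inductive.
  expPartial-* : ∀ N → expPartial q N ℚ.* ι (2 ^ N) ℚ.+ ι (2 ^ x) ℚ.≤ ι (2 ^ suc x * 2 ^ N)
  expPartial-* zero    = begin
    1ℚ ℚ.+ ι (2 ^ x)            ≡⟨ ι-+ 1 (2 ^ x) ⟨
    ι (1 + 2 ^ x)               ≤⟨ ι-mono-≤ (≤-trans (+-monoˡ-≤ (2 ^ x) (m^n>0 2 x)) (≤-reflexive (double (2 ^ x)))) ⟩
    ι (2 ^ suc x * 1)           ∎
    where
    open ℚ.≤-Reasoning
    double : ∀ a → a + a ≡ 2 * a * 1
    double = solve-∀
  expPartial-* (suc N) = begin
    (s ℚ.+ t) ℚ.* ι (2 * 2 ^ N) ℚ.+ ι (2 ^ x)
      ≡⟨ cong (ℚ._+ ι (2 ^ x)) (ℚ.*-distribʳ-+ (ι (2 * 2 ^ N)) s t) ⟩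
    s ℚ.* ι (2 * 2 ^ N) ℚ.+ t ℚ.* ι (2 * 2 ^ N) ℚ.+ ι (2 ^ x)
      ≤⟨ ℚ.+-monoˡ-≤ (ι (2 ^ x)) (ℚ.+-monoʳ-≤ (s ℚ.* ι (2 * 2 ^ N)) (expTerm≤ (suc N))) ⟩
    s ℚ.* ι (2 * 2 ^ N) ℚ.+ ι (2 ^ x) ℚ.+ ι (2 ^ x)
      ≡⟨ cong (λ a → s ℚ.* a ℚ.+ ι (2 ^ x) ℚ.+ ι (2 ^ x)) (trans (cong (λ a → ι (2 ^ N + a)) (+-identityʳ (2 ^ N))) (ι-+ (2 ^ N) (2 ^ N))) ⟩
    s ℚ.* (ι (2 ^ N) ℚ.+ ι (2 ^ N)) ℚ.+ ι (2 ^ x) ℚ.+ ι (2 ^ x)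
      ≡⟨ regroup s (ι (2 ^ N)) (ι (2 ^ x)) ⟩
    (s ℚ.* ι (2 ^ N) ℚ.+ ι (2 ^ x)) ℚ.+ (s ℚ.* ι (2 ^ N) ℚ.+ ι (2 ^ x))
      ≤⟨ ℚ.+-mono-≤ (expPartial-* N) (expPartial-* N) ⟩
    ι (2 ^ suc x * 2 ^ N) ℚ.+ ι (2 ^ suc x * 2 ^ N)
      ≡⟨ ι-+ (2 ^ suc x * 2 ^ N) (2 ^ suc x * 2 ^ N) ⟨
    ι (2 ^ suc x * 2 ^ N + 2 ^ suc x * 2 ^ N)
      ≡⟨ cong ι (double (2 ^ suc x) (2 ^ N)) ⟩
    ι (2 ^ suc x * 2 ^ suc N) ∎
    where
    open ℚ.≤-Reasoning
    s = expPartial q N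
    t = expTerm q (suc N)
    double : ∀ a b → a * b + a * b ≡ a * (2 * b)
    double = solve-∀
    regroup : ∀ s u v → s ℚ.* (u ℚ.+ u) ℚ.+ v ℚ.+ v ≡ (s ℚ.* u ℚ.+ v) ℚ.+ (s ℚ.* u ℚ.+ v)
    regroup = solve 3 (λ s u v → s :* (u :+ u) :+ v :+ v := (s :* u :+ v) :+ (s :* u :+ v)) refl
      where open +-*-Solver

  expPartial≤ : ∀ N → expPartial q N ℚ.≤ ι (2 ^ suc x)
  expPartial≤ N = ℚ.*-cancelʳ-≤-pos (ι (2 ^ N)) {{ι-pos (2 ^ N) {{m^n≢0 2 N}}}} (begin
    expPartial q N ℚ.* ι (2 ^ N)                      ≡⟨ ℚ.+-identityʳ _ ⟨
    expPartial q N ℚ.* ι (2 ^ N) ℚ.+ 0ℚ               ≤⟨ ℚ.+-monoʳ-≤ (expPartial q N ℚ.* ι (2 ^ N)) (ι-mono-≤ {0} {2 ^ x} z≤n) ⟩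
    expPartial q N ℚ.* ι (2 ^ N) ℚ.+ ι (2 ^ x)        ≤⟨ expPartial-* N ⟩
    ι (2 ^ suc x * 2 ^ N)                             ≡⟨ ι-* (2 ^ suc x) (2 ^ N) ⟩
    ι (2 ^ suc x) ℚ.* ι (2 ^ N)                       ∎)
    where open ℚ.≤-Reasoning

  LnAtMost⇒≤2^ : ∀ {n} → LnAtMost n q → n ≤ 2 ^ suc x
  -- The choice ε = 1 suffices because n and 2^(x + 1) are integers.
  LnAtMost⇒≤2^ {n} ln with N , n< ← ln 1ℚ (ℚ.positive⁻¹ 1ℚ) = s≤s⁻¹ (subst (n <_) (+-comm (2 ^ suc x) 1) (ι-cancel-< (begin-strict
    ι n                               <⟨ n< ⟩
    expPartial q N ℚ.+ 1ℚ             ≤⟨ ℚ.+-monoˡ-≤ 1ℚ (expPartial≤ N) ⟩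
    ι (2 ^ suc x) ℚ.+ ι 1             ≡⟨ ι-+ (2 ^ suc x) 1 ⟨
    ι (2 ^ suc x + 1)                 ∎)))
    where open ℚ.≤-Reasoning

ratio≤ : ∀ a b x → 4 * a ≤ x * suc b → ratio a (suc b) ℚ.* ι 4 ℚ.≤ ι x
ratio≤ a b x 4a≤xb = ℚ.*-cancelʳ-≤-pos (ι (suc b)) {{ι-pos (suc b)}} (begin
  (pos a / suc b) ℚ.* ι 4 ℚ.* ι (suc b)       ≡⟨ reorder (pos a / suc b) (ι 4) (ι (suc b)) ⟩
  ι 4 ℚ.* ((pos a / suc b) ℚ.* ι (suc b))     ≡⟨ cong (ι 4 ℚ.*_) (/-*-ι a b) ⟩
  ι 4 ℚ.* ι a                               ≡⟨ ι-* 4 a ⟨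
  ι (4 * a)                                 ≤⟨ ι-mono-≤ 4a≤xb ⟩
  ι (x * suc b)                             ≡⟨ ι-* x (suc b) ⟩
  ι x ℚ.* ι (suc b)                         ∎)
  where
  open ℚ.≤-Reasoning
  reorder : ∀ p q r → p ℚ.* q ℚ.* r ≡ q ℚ.* (p ℚ.* r)
  reorder = solve 3 (λ p q r → p :* q :* r := q :* (p :* r)) refl
    where open +-*-Solver

LnAtMost-ratio⇒< : ∀ {n} a b x .{{_ : NonZero b}} → LnAtMost n (ratio a b) → 2 ^ suc x < n → x * b < 4 * a
LnAtMost-ratio⇒< {n} a (suc b) x ln 2^<n = ≰⇒> λ 4a≤xb →
  <⇒≱ 2^<n (LnAtMost⇒≤2^ {ratio a (suc b)} {{ℚ.normalize-nonNeg a (suc b)}} {x} (ratio≤ a b x 4a≤xb) ln)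

-- Even covers from collisions of ∂

even⇒Even : ∀ a → odd a ≡ false → Even a
even⇒Even zero          _ = 0 , refl
even⇒Even (suc (suc a)) p with t , a≡t+t ← even⇒Even a (trans (sym (not-involutive (odd a))) p) =
  suc t , cong suc (trans (cong suc a≡t+t) (sym (+-suc t t)))

_≟ˢ_ : ∀ {n} (x y : Subset n) → Dec (x ≡ y)
_≟ˢ_ = ≡-dec Bool._≟_

Collision : ∀ {n m} → (Fin m → Subset n) → ℕ → Set
Collision {m = m} e ℓ = ∃ λ (A : Subset m) → ∃ λ (B : Subset m) → ∣ A ∣ ≡ ℓ × ∣ B ∣ ≡ ℓ × ∂ e A ≡ ∂ e B × A ≢ B

-- A search over finitely many pairs; it makes the pigeonhole argument by contradiction
-- constructive.
collision? : ∀ {n m} (e : Fin m → Subset n) ℓ → Dec (Collision e ℓ)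
collision? e ℓ = anySubset? λ A → anySubset? λ B →
  (∣ A ∣ ≟ ℓ) ×-dec (∣ B ∣ ≟ ℓ) ×-dec (∂ e A ≟ˢ ∂ e B) ×-dec ¬? (A ≟ˢ B)

collision : ∀ {n m} (e : Fin m → Subset n) V → (∀ x → V x ≤ 1) → ∀ D ℓ → 6 * ℓ ≤ D →
  2 * D * ∑ (subsets n) V < energy e V → ∑ (subsets n) V < 5 ^ ℓ → Collision e ℓ
collision {n} e V V≤1 D ℓ 6ℓ≤D dense small with collision? e ℓ
... | yes c   = c
... | no none with W , W≤V , (s , 0<Ws) , minDegree ← prune e (∑ (subsets n) V) D V ≤-refl dense =
  contradiction small (≤⇒≯ (begin
    5 ^ ℓ                                     ≤⟨ reached-grows e W W≤1 D minDegree s 0<Ws ℓ 6ℓ≤D ⟩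
    reached e W W≤1 D minDegree s 0<Ws ℓ      ≤⟨ reached≤ e W W≤1 D minDegree s 0<Ws ℓ ∂-injective ⟩
    ∑ (subsets n) W                           ≤⟨ ∑-mono-≤ (subsets n) W≤V ⟩
    ∑ (subsets n) V                           ∎))
  where
  open ≤-Reasoning
  W≤1 : ∀ x → W x ≤ 1
  W≤1 x = ≤-trans (W≤V x) (V≤1 x)
  ∂-injective : ∀ A B → ∣ A ∣ ≡ ℓ → ∣ B ∣ ≡ ℓ → ∂ e A ≡ ∂ e B → A ≡ B
  ∂-injective A B p q ∂≡ with A ≟ˢ B
  ... | yes A≡B = A≡B
  ... | no  A≢B = contradiction (A , B , p , q , ∂≡ , A≢B) none

collision⇒evenCover : ∀ {n k m} (H : Hypergraph n k m) ℓ → Collision (edge H) ℓ →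
  ∃ λ (C : Subset m) → IsEvenCover H C × ∣ C ∣ ≤ ℓ + ℓ
collision⇒evenCover {n} H ℓ (A , B , ∣A∣≡ℓ , ∣B∣≡ℓ , ∂≡ , A≢B) =
  A ⊕ B , (nonempty , λ v → even⇒Even (degreeIn H (A ⊕ B) v) (even v)) ,
  ≤-trans (∣⊕∣≤ A B) (≤-reflexive (cong₂ _+_ ∣A∣≡ℓ ∣B∣≡ℓ))
  where
  open ≡-Reasoning
  nonempty : ∃ λ i → i ∈ A ⊕ B
  nonempty with i , p ← ⊕-distinct A≢B = i , lookup⇒[]= i (A ⊕ B) p
  even : ∀ v → odd (degreeIn H (A ⊕ B) v) ≡ false
  even v = begin
    odd (degreeIn H (A ⊕ B) v)                              ≡⟨ lookup∘tabulate (odd ∘ degreeIn H (A ⊕ B)) v ⟨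
    lookup (∂ (edge H) (A ⊕ B)) v                           ≡⟨ cong (λ x → lookup x v) (trans (∂-⊕ (edge H) A B) (cong (_⊕ ∂ (edge H) B) ∂≡)) ⟩
    lookup (∂ (edge H) B ⊕ ∂ (edge H) B) v                  ≡⟨ lookup-zipWith _xor_ v (∂ (edge H) B) (∂ (edge H) B) ⟩
    lookup (∂ (edge H) B) v xor lookup (∂ (edge H) B) v     ≡⟨ xor-same (lookup (∂ (edge H) B) v) ⟩
    false ∎

-- An r-set containing exactly j of the 2 j points of a hyperedge keeps its size when the hyperedge
-- is added. There are C(2 j, j) C(n - 2 j, r - j) such sets, with a = r - j and b = n - r - j.
energy-sized≥ : ∀ j a b {m} (H : Hypergraph (a + j + (b + j)) (2 * j) m) →
  m * (binom j j * binom a b) ≤ energy (edge H) (sized (a + j))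
energy-sized≥ j a b {m} H = begin
  m * (binom j j * binom a b)
    ≡⟨ ∑-fins-const m (binom j j * binom a b) ⟨
  ∑ (fins m) (λ c → binom j j * binom a b)
    ≤⟨ ∑-mono-≤ (fins m) (λ c → ∑-sized-pairs (edge H c) j j a b (size c) (cosize c)) ⟩
  ∑ (fins m) (λ c → ∑ (subsets n) (λ x → sized (j + a) x * sized (j + a) (x ⊕ edge H c)))
    ≡⟨ ∑-swap (fins m) (subsets n) _ ⟩
  ∑ (subsets n) (λ x → ∑ (fins m) (λ c → sized (j + a) x * sized (j + a) (x ⊕ edge H c)))
    ≡⟨ ∑-cong (subsets n) (λ x → ∑-*ˡ (fins m) (sized (j + a) x) _) ⟩
  energy (edge H) (sized (j + a))
    ≡⟨ cong (λ r → energy (edge H) (sized r)) (+-comm j a) ⟩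
  energy (edge H) (sized (a + j)) ∎
  where
  open ≤-Reasoning
  n = a + j + (b + j)
  size : ∀ c → ∣ edge H c ∣ ≡ j + j
  size c = trans (uniform H c) (cong (j +_) (+-identityʳ j))
  regroup : ∀ a b j → a + j + (b + j) ≡ a + b + (j + j)
  regroup = solve-∀
  cosize : ∀ c → ∣ ∁ (edge H c) ∣ ≡ a + b
  cosize c = trans (∣∁p∣≡n∸∣p∣ (edge H c)) (trans (cong₂ _∸_ (regroup a b j) (size c)) (m+n∸n≡m (a + b) (j + j)))

-- Dividing `energy-sized≥` by the number N of r-sets turns the average degree into m times the
-- probability bounded by `binom-balanced`. Both N and n^j are then cancelled.
energy-sized> : ∀ j a b D {m} (H : Hypergraph (a + j + (b + j)) (2 * j) m) → j ≤ a → a ≤ b →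
  2 * D * (a + j + (b + j)) ^ j < m * (a + j) ^ j →
  2 * D * ∑ (subsets (a + j + (b + j))) (sized (a + j)) < energy (edge H) (sized (a + j))
energy-sized> j a b D {m} H j≤a a≤b dense = begin-strict
  2 * D * ∑ (subsets n) (sized r)       ≤⟨ *-monoʳ-≤ (2 * D) (∑-sized r s) ⟩
  2 * D * N                             <⟨ *-cancelʳ-< (n ^ j) (2 * D * N) _ scaled ⟩
  m * (binom j j * binom a b)           ≤⟨ energy-sized≥ j a b H ⟩
  energy (edge H) (sized r)             ∎
  where
  open ≤-Reasoning
  r = a + j
  s = b + j
  n = r + s
  N = binom r s
  instance
    N≢0 : NonZero N
    N≢0 = >-nonZero (0<binom r s)
  reorder₁ : ∀ d N n → d * N * n ≡ d * n * N
  reorder₁ = solve-∀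
  reorder₂ : ∀ m r N → m * r * N ≡ m * (N * r)
  reorder₂ = solve-∀
  scaled : 2 * D * N * n ^ j < m * (binom j j * binom a b) * n ^ j
  scaled = begin-strict
    2 * D * N * n ^ j                          ≡⟨ reorder₁ (2 * D) N (n ^ j) ⟩
    2 * D * n ^ j * N                          <⟨ *-monoˡ-< N dense ⟩
    m * r ^ j * N                              ≡⟨ reorder₂ m (r ^ j) N ⟩
    m * (N * r ^ j)                            ≤⟨ *-monoʳ-≤ m (binom-balanced j a b j≤a a≤b) ⟩
    m * (binom j j * binom a b * n ^ j)        ≡⟨ *-assoc m (binom j j * binom a b) (n ^ j) ⟨
    m * (binom j j * binom a b) * n ^ j        ∎

-- Arithmetic of the parameters

n≤2^⌈log₂n⌉ : ∀ n → n ≤ 2 ^ ⌈log₂ n ⌉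
n≤2^⌈log₂n⌉ = <-rec _ step
  where
  step : ∀ n → (∀ {i} → i < n → i ≤ 2 ^ ⌈log₂ i ⌉) → n ≤ 2 ^ ⌈log₂ n ⌉
  step zero          rec = z≤n
  step (suc zero)    rec = ≤-refl
  step n@(suc (suc n₀)) rec = begin
    n                                ≡⟨ ⌊n/2⌋+⌈n/2⌉≡n n ⟨
    ⌊ n /2⌋ + ⌈ n /2⌉                ≤⟨ +-monoˡ-≤ ⌈ n /2⌉ (⌊n/2⌋≤⌈n/2⌉ n) ⟩
    ⌈ n /2⌉ + ⌈ n /2⌉                ≤⟨ +-mono-≤ half (≤-trans half (m≤m+n _ 0)) ⟩
    2 ^ suc (⌈log₂ n ⌉ ∸ 1)          ≡⟨ cong (2 ^_) (m+[n∸m]≡n (⌈log₂⌉-mono-≤ {2} {n} (s≤s (s≤s z≤n)))) ⟩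
    2 ^ ⌈log₂ n ⌉                    ∎
    where
    open ≤-Reasoning
    half : ⌈ n /2⌉ ≤ 2 ^ (⌈log₂ n ⌉ ∸ 1)
    half = subst (λ t → ⌈ n /2⌉ ≤ 2 ^ t) (⌈log₂⌈n/2⌉⌉≡⌈log₂n⌉∸1 n) (rec (⌈n/2⌉<n n₀))

-- Let L = ⌈log₂ n⌉ and y = L - 2. Then 2^(y + 1) = 2^(L - 1) < n, so the rational bounding ln n
-- exceeds y/4 and m r^i > 32 y n^(i + 1). From n ≥ 16 follows y ≥ 2, so the required factor 12 L =
-- 12 (y + 2) is at most 24 y.
LnAtMost⇒dense : ∀ n r m i → 16 ≤ n → 1 ≤ r →
  LnAtMost n (ratio (m * r ^ i) (128 * n * n ^ i)) →
  2 * (6 * (⌈log₂ n ⌉ * r)) * n ^ suc i < m * r ^ suc i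
LnAtMost⇒dense n r m i 16≤n 1≤r ln = *-cancelˡ-< 4 _ _ (begin-strict
  4 * (2 * (6 * (L * r)) * n ^ suc i)      ≡⟨ cong (λ t → 4 * (2 * (6 * (t * r)) * n ^ suc i)) L≡2+y ⟩
  4 * (2 * (6 * ((2 + y) * r)) * n ^ suc i) ≡⟨ e₁ y r (n ^ suc i) ⟩
  (48 * 2 + 48 * y) * (r * n ^ suc i)       ≤⟨ *-monoˡ-≤ (r * n ^ suc i) (+-monoˡ-≤ (48 * y) (*-monoʳ-≤ 48 2≤y)) ⟩
  (48 * y + 48 * y) * (r * n ^ suc i)       ≤⟨ *-monoˡ-≤ (r * n ^ suc i) (≤-trans (m≤m+n (48 * y + 48 * y) (32 * y)) (≤-reflexive (e₂ y))) ⟩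
  128 * y * (r * n ^ suc i)                 ≡⟨ e₃ y r n (n ^ i) ⟩
  y * (128 * n * n ^ i) * r                 <⟨ *-monoˡ-< r (LnAtMost-ratio⇒< (m * r ^ i) (128 * n * n ^ i) y ln 2^<n) ⟩
  4 * (m * r ^ i) * r                       ≡⟨ e₄ m r (r ^ i) ⟩
  4 * (m * r ^ suc i)                       ∎)
  where
  open ≤-Reasoning
  L = ⌈log₂ n ⌉
  y = L ∸ 2
  instance
    n≢0 : NonZero n
    n≢0 = >-nonZero (≤-trans (s≤s z≤n) 16≤n)
    r≢0 : NonZero r
    r≢0 = >-nonZero 1≤r
    denominator≢0 : NonZero (128 * n * n ^ i)
    denominator≢0 = m*n≢0 (128 * n) (n ^ i) {{m*n≢0 128 n}} {{m^n≢0 n i}}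
  4≤L : 4 ≤ L
  4≤L = subst (_≤ L) (⌈log₂2^n⌉≡n 4) (⌈log₂⌉-mono-≤ 16≤n)
  L≡2+y : L ≡ 2 + y
  L≡2+y = sym (m+[n∸m]≡n (≤-trans (s≤s (s≤s z≤n)) 4≤L))
  2≤y : 2 ≤ y
  2≤y = ∸-monoˡ-≤ 2 4≤L
  2^<n : 2 ^ suc y < n
  2^<n = ≰⇒> λ n≤2^ → <-irrefl refl (begin-strict
    suc y                    <⟨ ≤-reflexive (sym L≡2+y) ⟩
    L                        ≤⟨ ⌈log₂⌉-mono-≤ n≤2^ ⟩
    ⌈log₂ (2 ^ suc y) ⌉      ≡⟨ ⌈log₂2^n⌉≡n (suc y) ⟩
    suc y                    ∎)
  e₁ : ∀ y r N → 4 * (2 * (6 * ((2 + y) * r)) * N) ≡ (48 * 2 + 48 * y) * (r * N)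
  e₁ = solve-∀
  e₂ : ∀ y → 48 * y + 48 * y + 32 * y ≡ 128 * y
  e₂ = solve-∀
  e₃ : ∀ y r n N → 128 * y * (r * (n * N)) ≡ y * (128 * n * N) * r
  e₃ = solve-∀
  e₄ : ∀ m r R → 4 * (m * R) * r ≡ 4 * (m * (r * R))
  e₄ = solve-∀

module _ (n r : ℕ) (2≤n : 2 ≤ n) (1≤r : 1 ≤ r) where

  private
    K = ⌈log₂ (n ^ r) ⌉
    ℓ = ⌈ K /2⌉

  halfLog≤ : ℓ + ℓ ≤ K + 1
  halfLog≤ = begin
    -- By definition ⌈K/2⌉ is ⌊(K + 1)/2⌋, so the second ℓ already is a floor.
    ℓ + ℓ                                ≤⟨ +-monoʳ-≤ ℓ (⌊n/2⌋≤⌈n/2⌉ (suc K)) ⟩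
    ⌊ suc K /2⌋ + ⌈ suc K /2⌉            ≡⟨ ⌊n/2⌋+⌈n/2⌉≡n (suc K) ⟩
    suc K                                ≡⟨ +-comm 1 K ⟩
    K + 1                                ∎
    where open ≤-Reasoning

  -- Multiplied by 6, this is the condition 6 ℓ ≤ D of the growth estimate.
  halfLog≤log*r : ℓ ≤ ⌈log₂ n ⌉ * r
  halfLog≤log*r = begin
    ℓ                                    ≤⟨ ⌈n/2⌉≤n K ⟩
    K                                    ≤⟨ ⌈log₂⌉-mono-≤ (^-monoˡ-≤ r (n≤2^⌈log₂n⌉ n)) ⟩
    ⌈log₂ ((2 ^ ⌈log₂ n ⌉) ^ r) ⌉        ≡⟨ cong ⌈log₂_⌉ (^-*-assoc 2 ⌈log₂ n ⌉ r) ⟩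
    ⌈log₂ (2 ^ (⌈log₂ n ⌉ * r)) ⌉        ≡⟨ ⌈log₂2^n⌉≡n (⌈log₂ n ⌉ * r) ⟩
    ⌈log₂ n ⌉ * r                        ∎
    where open ≤-Reasoning

  -- Already 4^ℓ reaches n^r, possibly with equality; base 5 and ℓ > 0 make the comparison strict.
  n^r<5^halfLog : n ^ r < 5 ^ ℓ
  n^r<5^halfLog = begin-strict
    n ^ r                                ≤⟨ n≤2^⌈log₂n⌉ (n ^ r) ⟩
    2 ^ K                                ≡⟨ cong (2 ^_) (⌊n/2⌋+⌈n/2⌉≡n K) ⟨
    2 ^ (⌊ K /2⌋ + ℓ)                    ≤⟨ ^-monoʳ-≤ 2 (+-monoˡ-≤ ℓ (⌊n/2⌋≤⌈n/2⌉ K)) ⟩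
    2 ^ (ℓ + ℓ)                          ≡⟨ ^-distribˡ-+-* 2 ℓ ℓ ⟩
    2 ^ ℓ * 2 ^ ℓ                        ≡⟨ 4^≡2^*2^ ℓ ⟨
    4 ^ ℓ                                <⟨ ^-monoˡ-< ℓ {{>-nonZero 0<ℓ}} (n<1+n 4) ⟩
    5 ^ ℓ                                ∎
    where
    open ≤-Reasoning
    2≤n^r : 2 ≤ n ^ r
    2≤n^r = ≤-trans 2≤n (≤-trans (≤-reflexive (sym (*-identityʳ n)))
              (^-monoʳ-≤ n {{>-nonZero (≤-trans (s≤s z≤n) 2≤n)}} 1≤r))
    0<ℓ : 0 < ℓ
    0<ℓ = ⌈n/2⌉-mono (⌈log₂⌉-mono-≤ 2≤n^r)

-- Here a and b count the points outside a hyperedge that lie inside and outside an r-set splitting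
-- it evenly. Writing r and n in terms of them removes subtraction from the counting lemmas.
decompose : ∀ {j r n} → 2 * j ≤ r → 8 * r ≤ n →
  ∃ λ a → ∃ λ b → r ≡ a + j × n ≡ r + (b + j)
decompose {j} {r} {n} 2j≤r 8r≤n =
  r ∸ j , n ∸ (r + j) , sym (m∸n+n≡m j≤r) ,
  trans (sym (m∸n+n≡m r+j≤n)) (regroup (n ∸ (r + j)) r j)
  where
  regroup : ∀ b r j → b + (r + j) ≡ r + (b + j)
  regroup = solve-∀
  j≤r : j ≤ r
  j≤r = ≤-trans (m≤m+n j _) 2j≤r
  r+j≤n : r + j ≤ n
  r+j≤n = ≤-trans (+-monoʳ-≤ r (≤-trans j≤r (m≤m+n r _))) 8r≤n

-- Assembly of the proof

evenCover : ∀ i a b m → let j = suc i; r = a + j; n = r + (b + j) in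
  2 * j ≤ r → 8 * r ≤ n → (H : Hypergraph n (2 * j) m) →
  LnAtMost n (ratio (m * r ^ i) (128 * n * n ^ i)) →
  ∃ λ (C : Subset m) → IsEvenCover H C × ∣ C ∣ ≤ ⌈log₂ (n ^ r) ⌉ + 1
evenCover i a b m 2j≤r 8r≤n H ln =
  let C , cover , size = collision⇒evenCover H ℓ (collision (edge H) (sized r) (λ x → κ≤1 ∣ x ∣ r) D ℓ
        (*-monoʳ-≤ 6 (halfLog≤log*r n r 2≤n 1≤r))
        (energy-sized> (suc i) a b D H j≤a a≤b (LnAtMost⇒dense n r m i 16≤n 1≤r ln))
        (≤-<-trans (≤-trans (∑-sized r (b + suc i)) (binom≤ r (b + suc i))) (n^r<5^halfLog n r 2≤n 1≤r)))
  in C , cover , ≤-trans size (halfLog≤ n r 2≤n 1≤r)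
  where
  r = a + suc i
  n = r + (b + suc i)
  ℓ = ⌈ ⌈log₂ (n ^ r) ⌉ /2⌉
  D = 6 * (⌈log₂ n ⌉ * r)
  j≤a : suc i ≤ a
  j≤a = +-cancelʳ-≤ (suc i) (suc i) a (subst (_≤ a + suc i) (cong (suc i +_) (+-identityʳ (suc i))) 2j≤r)
  -- Follows from 2 r ≤ n; the stronger bound 8 r ≤ n, with r ≥ 2, also yields n ≥ 16.
  a≤b : a ≤ b
  a≤b = +-cancelʳ-≤ (suc i) a b (+-cancelˡ-≤ r (a + suc i) (b + suc i) (≤-trans (≤-trans (m≤m+n (r + r) (6 * r)) (≤-reflexive (regroup r))) 8r≤n))
    where
    regroup : ∀ r → r + r + 6 * r ≡ 8 * r
    regroup = solve-∀
  2≤r : 2 ≤ r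
  2≤r = ≤-trans (*-monoʳ-≤ 2 (s≤s (z≤n {i}))) 2j≤r
  1≤r : 1 ≤ r
  1≤r = ≤-trans (s≤s z≤n) 2≤r
  16≤n : 16 ≤ n
  16≤n = ≤-trans (*-monoʳ-≤ 8 2≤r) 8r≤n
  2≤n : 2 ≤ n
  2≤n = ≤-trans (s≤s (s≤s z≤n)) 16≤n

theorem2p3 : (n k r m j : ℕ) → k ≡ 2 * j → 2 ≤ k → k ≤ r → 8 * r ≤ n →
    (H : Hypergraph n k m) →
    LnAtMost n (ratio (m * r ^ (j ∸ 1)) (128 * n * n ^ (j ∸ 1))) →
    ∃ λ (C : Subset m) → IsEvenCover H C × ∣ C ∣ ≤ ⌈log₂ (n ^ r) ⌉ + 1
-- Since k ≥ 2 rules out j = 0, the exponent j ∸ 1 is a genuine predecessor.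
theorem2p3 n k r m (suc i) refl 2≤k k≤r 8r≤n H ln
  with a , b , refl , refl ← decompose {suc i} k≤r 8r≤n = evenCover i a b m k≤r 8r≤n H ln
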